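{- Let $G$ be a connected graph of order $n\ge2$ with $\mathrm{mr}_+^{\mathbb{R}}(G)=\mathrm{mr}_+^{\mathbb{C}}(G)=:\mathrm{mr}_+(G)$ and $OS(G)=\mathrm{mr}_+(G)$, and let $H$ be a connected graph with more than one vertex with $\mathrm{mr}_+^{\mathbb{R}}(H)=\mathrm{mr}_+^{\mathbb{C}}(H)=:\mathrm{mr}_+(H)$ and $OS(H)=\mathrm{mr}_+(H)$. Then $\mathrm{mr}_+^{\mathbb{R}}(G\circ H)=\mathrm{mr}_+^{\mathbb{C}}(G\circ H)$, and this common value $\mathrm{mr}_+(G\circ H)$ satisfies $$\mathrm{mr}_+(G\circ H)=n\,\mathrm{mr}_+(H)+\mathrm{mr}_+(G).$$
   Context: All graphs are finite and simple. For an $N\times N$ Hermitian matrix $A$, $\mathcal{G}(A)$ is the simple graph on $\{1,\dots,N\}$ in which distinct $i,j$ are adjacent iff $A_{ij}\ne0$ (the diagonal is unconstrained). For a graph $G$ on $N$ vertices, $\mathrm{mr}_+^{\mathbb{R}}(G)$ (resp. $\mathrm{mr}_+^{\mathbb{C}}(G)$) is the minimum rank of a real symmetric (resp. complex Hermitian) positive semidefinite $N\times N$ matrix $B$ with $\mathcal{G}(B)=G$. If the two numbers are equal, the common value is denoted $\mathrm{mr}_+(G)$. OS-number: let $G=(V,E)$ be a connected graph with more than one vertex and $S=\{v_1,\dots,v_r\}$ an ordered set of (distinct) vertices of $G$. For $1\le k\le r$ let $G_k$ be the subgraph induced by $v_1,\dots,v_k$, and let $H_k=(V_k,E_k)$ be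 the connected component of $G_k$ containing $v_k$. If for each $k$ there is $w_k\in V$ with $w_k\ne v_l$ for all $l\le k$, $\{v_k,w_k\}\in E$, and $\{w_k,v_l\}\notin E$ for all $v_l\in V_k$ with $l\ne k$, then $S$ is called an OS-vertex set. $OS(G)$ is the maximum cardinality of an OS-vertex set of $G$. The corona product $G_1\circ G_2$ of $G_1=(V_1,E_1)$ with $G_2=(V_2,E_2)$ is the graph of order $|V_1||V_2|+|V_1|$ obtained by taking one copy of $G_1$ and $|V_1|$ copies of $G_2$, and joining every vertex of the $i$th copy of $G_2$ to the $i$th vertex of $G_1$. -}

module Defs where

open import Algebra.Bundles using (CommutativeRing)
open import Algebra.Bundles.Raw using (RawRing)
import Algebra.Definitions.RawMonoid as Summation
open import Data.Fin.Base as Fin using (Fin; splitAt; remQuot)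
import Data.Fin.Properties as Fin
open import Data.Nat.Base as ℕ using (ℕ)
open import Data.Product.Base using (Σ; ∃; ∃-syntax; _×_; _,_)
open import Data.Sum.Base using (_⊎_; inj₁; inj₂; map₂)
open import Data.Vec.Functional using (Vector)
open import Function.Base using (id; _on_)
open import Function.Bundles using (_⇔_)
open import Function.Definitions using (Injective)
open import Level using (Level; 0ℓ; suc; _⊔_)
open import Relation.Binary.Construct.Closure.ReflexiveTransitive using (Star)
open import Relation.Binary.Core using (Rel)
open import Relation.Binary.Definitions using (Symmetric; Decidable)
open import Relation.Binary.PropositionalEquality using (_≡_; _≢_; sym)
open import Relation.Binary.Structures using (IsDecTotalOrder)
open import Relation.Nullary using (¬_; _×-dec_)
open import Relation.Unary using (Pred)

private variable
  p ℓ c ℓ₁ ℓ₂ : Level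

------------------------------------------------------------------------
-- Minima and maxima of sets of natural numbers

IsMinimum : Pred ℕ p → Pred ℕ p
IsMinimum P k = P k × (∀ j → P j → k ℕ.≤ j)

IsMaximum : Pred ℕ p → Pred ℕ p
IsMaximum P k = P k × (∀ j → P j → j ℕ.≤ k)

------------------------------------------------------------------------
-- The real numbers, given by their axioms: a Dedekind-complete ordered
-- field. Trichotomy, a theorem of classical mathematics, is part of the
-- axioms here in the form of a decidable total order. Such a field is
-- unique up to isomorphism.

record Reals ℓ : Set (suc ℓ) where
  field
    commutativeRing : CommutativeRing ℓ ℓ

  open CommutativeRing commutativeRing public

  infix 4 _≤_
  field
    _≤_             : Rel Carrier ℓ
    isDecTotalOrder : IsDecTotalOrder _≈_ _≤_
    1≉0             : ¬ (1# ≈ 0#)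
    inverse         : ∀ x → ¬ (x ≈ 0#) → ∃[ y ] x * y ≈ 1#
    +-monoʳ-≤       : ∀ x {y z} → y ≤ z → x + y ≤ x + z
    *-nonNegative   : ∀ {x y} → 0# ≤ x → 0# ≤ y → 0# ≤ x * y

  UpperBound : Pred Carrier ℓ → Pred Carrier ℓ
  UpperBound P b = ∀ x → P x → x ≤ b

  field
    supremum : ∀ (P : Pred Carrier ℓ) → ∃ P → ∃ (UpperBound P) →
               ∃[ s ] UpperBound P s × (∀ b → UpperBound P b → s ≤ b)

------------------------------------------------------------------------
-- The two kinds of scalars. `NonNegative z` says that z is a real number
-- and z ≥ 0.

record Scalars c ℓ₁ ℓ₂ : Set (suc (c ⊔ ℓ₁ ⊔ ℓ₂)) where
  field
    rawRing : RawRing c ℓ₁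

  open RawRing rawRing public

  field
    conj        : Carrier → Carrier
    NonNegative : Pred Carrier ℓ₂

  open Summation +-rawMonoid public using (sum)

realScalars : Reals ℓ → Scalars ℓ ℓ ℓ
realScalars ℛ = record
  { rawRing     = rawRing
  ; conj        = id
  ; NonNegative = λ x → 0# ≤ x
  }
  where open Reals ℛ

-- The pair (a , b) stands for a + b i.
complexScalars : Reals ℓ → Scalars ℓ ℓ ℓ
complexScalars ℛ = record
  { rawRing = record
    { Carrier = Carrier × Carrier
    ; _≈_     = λ { (a , b) (a′ , b′) → (a ≈ a′) × (b ≈ b′) }
    ; _+_     = λ { (a , b) (a′ , b′) → a + a′ , b + b′ }
    ; _*_     = λ { (a , b) (a′ , b′) → a * a′ - b * b′ , a * b′ + b * a′ }
    ; -_      = λ { (a , b) → - a , - b }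
    ; 0#      = 0# , 0#
    ; 1#      = 1# , 0#
    }
  ; conj        = λ { (a , b) → a , - b }
  ; NonNegative = λ { (a , b) → (b ≈ 0#) × (0# ≤ a) }
  }
  where open Reals ℛ

------------------------------------------------------------------------
-- Finite simple graphs on the vertex set Fin n

record Graph (n : ℕ) : Set₁ where
  field
    Adj    : Rel (Fin n) 0ℓ
    adj?   : Decidable Adj
    symm   : Symmetric Adj
    irrefl : ∀ {i} → ¬ Adj i i

Connected : ∀ {n} → Graph n → Set
Connected G = ∀ i j → Star (Graph.Adj G) i j

------------------------------------------------------------------------
-- Matrices

module Matrices (K : Scalars c ℓ₁ ℓ₂) where
  open Scalars K

  Matrix : ℕ → Set c
  Matrix n = Fin n → Fin n → Carrier

  LinearlyIndependent : ∀ {k n} → (Fin k → Vector Carrier n) → Set (c ⊔ ℓ₁)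
  LinearlyIndependent {k} v =
    ∀ (a : Vector Carrier k) →
    (∀ i → sum (λ j → a j * v j i) ≈ 0#) → ∀ j → a j ≈ 0#

  -- The maximum number of linearly independent columns. Independence
  -- forces the selection σ of columns to be injective.
  IsRank : ∀ {n} → Matrix n → Pred ℕ (c ⊔ ℓ₁)
  IsRank {n} A = IsMaximum λ k →
    Σ (Fin k → Fin n) λ σ → LinearlyIndependent (λ j i → A i (σ j))

  IsHermitian : ∀ {n} → Matrix n → Set ℓ₁
  IsHermitian A = ∀ i j → A i j ≈ conj (A j i)

  IsPositiveSemidefinite : ∀ {n} → Matrix n → Set (c ⊔ ℓ₁ ⊔ ℓ₂)
  IsPositiveSemidefinite {n} A = IsHermitian A ×
    (∀ (x : Vector Carrier n) →
      NonNegative (sum λ i → sum λ j → conj (x i) * A i j * x j))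

  HasGraph : ∀ {n} → Matrix n → Graph n → Set ℓ₁
  HasGraph A G = ∀ i j → i ≢ j → Graph.Adj G i j ⇔ (¬ (A i j ≈ 0#))

  IsMinimumPSDRank : ∀ {n} → Graph n → Pred ℕ (c ⊔ ℓ₁ ⊔ ℓ₂)
  IsMinimumPSDRank {n} G = IsMinimum λ r →
    Σ (Matrix n) λ B → IsPositiveSemidefinite B × HasGraph B G × IsRank B r

module _ (ℛ : Reals ℓ) where
  open Matrices

  IsMr₊ℝ IsMr₊ℂ : ∀ {n} → Graph n → Pred ℕ ℓ
  IsMr₊ℝ = IsMinimumPSDRank (realScalars ℛ)
  IsMr₊ℂ = IsMinimumPSDRank (complexScalars ℛ)

  -- The real and the complex minimum agree, and k is the common value.
  IsMr₊ : ∀ {n} → Graph n → Pred ℕ ℓ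
  IsMr₊ G k = IsMr₊ℝ G k × IsMr₊ℂ G k

------------------------------------------------------------------------
-- OS-number

module _ {n} (G : Graph n) where
  open Graph G

  -- `PrefixAdj v k` is adjacency in the subgraph induced by the v l with
  -- l ≤ k, with vertices named by their positions in the ordered set v.
  PrefixAdj : ∀ {r} → (Fin r → Fin n) → Fin r → Rel (Fin r) 0ℓ
  PrefixAdj v k a b = a Fin.≤ k × b Fin.≤ k × Adj (v a) (v b)

  -- The positions of the vertices in the component containing v k of the
  -- subgraph above.
  InComponent : ∀ {r} → (Fin r → Fin n) → Fin r → Pred (Fin r) 0ℓ
  InComponent v k l = Star (PrefixAdj v k) k l

  IsOSVertexSet : ∀ {r} → (Fin r → Fin n) → Set
  IsOSVertexSet v = Injective _≡_ _≡_ v ×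
    (∀ k → ∃[ w ] (∀ l → l Fin.≤ k → w ≢ v l)
                × Adj (v k) w
                × (∀ l → InComponent v k l → l ≢ k → ¬ Adj w (v l)))

  IsOSNumber : Pred ℕ 0ℓ
  IsOSNumber = IsMaximum λ r → Σ (Fin r → Fin n) IsOSVertexSet

------------------------------------------------------------------------
-- Corona product

module _ {n m} (G : Graph n) (H : Graph m) where
  private
    module G = Graph G
    module H = Graph H

  -- inj₁ i is the vertex i of G; inj₂ (i , a) is the vertex a of the ith
  -- copy of H.
  CoronaAdj : Rel (Fin n ⊎ Fin n × Fin m) 0ℓ
  CoronaAdj (inj₁ i)       (inj₁ j)       = G.Adj i j
  CoronaAdj (inj₁ i)       (inj₂ (j , _)) = i ≡ j
  CoronaAdj (inj₂ (i , _)) (inj₁ j)       = i ≡ j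
  CoronaAdj (inj₂ (i , a)) (inj₂ (j , b)) = i ≡ j × H.Adj a b

  coronaAdj? : Decidable CoronaAdj
  coronaAdj? (inj₁ i)       (inj₁ j)       = G.adj? i j
  coronaAdj? (inj₁ i)       (inj₂ (j , _)) = i Fin.≟ j
  coronaAdj? (inj₂ (i , _)) (inj₁ j)       = i Fin.≟ j
  coronaAdj? (inj₂ (i , a)) (inj₂ (j , b)) = i Fin.≟ j ×-dec H.adj? a b

  coronaAdj-symm : Symmetric CoronaAdj
  coronaAdj-symm {inj₁ _} {inj₁ _} e       = G.symm e
  coronaAdj-symm {inj₁ _} {inj₂ _} e       = sym e
  coronaAdj-symm {inj₂ _} {inj₁ _} e       = sym e
  coronaAdj-symm {inj₂ _} {inj₂ _} (e , f) = sym e , H.symm f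

  coronaAdj-irrefl : ∀ {x} → ¬ CoronaAdj x x
  coronaAdj-irrefl {inj₁ _} e       = G.irrefl e
  coronaAdj-irrefl {inj₂ _} (_ , f) = H.irrefl f

  coronaVertex : Fin (n ℕ.+ n ℕ.* m) → Fin n ⊎ Fin n × Fin m
  coronaVertex x = map₂ (remQuot m) (splitAt n x)

infixl 7 _∘ᶜ_

_∘ᶜ_ : ∀ {n m} → Graph n → Graph m → Graph (n ℕ.+ n ℕ.* m)
_∘ᶜ_ G H = record
  { Adj    = CoronaAdj G H on coronaVertex G H
  ; adj?   = λ x y → coronaAdj? G H (coronaVertex G H x) (coronaVertex G H y)
  ; symm   = λ {x} {y} →
      coronaAdj-symm G H {coronaVertex G H x} {coronaVertex G H y}
  ; irrefl = λ {x} → coronaAdj-irrefl G H {coronaVertex G H x}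
  }

{-# OPTIONS --safe #-}

-- Let M be positive semidefinite with graph G. In a linear relation between
-- the columns of an OS-vertex set v₁ , … , v_r of G whose coefficients after
-- position k vanish, the part supported on the component of v_k gives a
-- vector x with x* M x = 0, hence M x = 0. The row of w_k then shows that
-- the kth coefficient is 0. So OS(G) ≤ mr₊(G), over ℝ and over ℂ. The same
-- argument applies to the columns of G ∘ H belonging to an OS-vertex set in
-- each copy of H and then to one in G, and gives the lower bound.
--
-- Conversely, let A and B attain mr₊(G) and mr₊(H). Since no row of B is 0,
-- some y has all entries of B y nonzero. The Hermitian form
--   x₁* A x₁ + Σᵢ zᵢ* B zᵢ  with  zᵢ = x₁ᵢ y + x₂ᵢ,
-- where x₁ lives on G and x₂ᵢ on the ith copy of H, is positive semidefinite
-- with graph G ∘ H, and its rank is at most mr₊(G) + n mr₊(H).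
module Submission where

open import Defs
open import Algebra.Bundles using (AbelianGroup; CommutativeRing)
import Algebra.Consequences.Setoid
import Algebra.Construct.DirectProduct as DirectProduct
import Algebra.Morphism.Construct.Identity
open import Algebra.Morphism.Structures using (IsRingHomomorphism)
import Algebra.Properties.AbelianGroup
import Algebra.Properties.Group
import Algebra.Properties.Ring
import Algebra.Properties.Semiring.Sum
import Algebra.Solver.Ring.NaturalCoefficients.Default
open import Algebra.Structures using (IsCommutativeRing)
open import Data.Bool.Base using (if_then_else_)
open import Data.Empty using (⊥)
open import Data.Fin.Base as Fin using (Fin; zero; suc; punchIn; splitAt; join; remQuot; combine; _↑ˡ_; _↑ʳ_)
import Data.Fin.Induction as Fin
import Data.Fin.Properties as Fin
open import Data.Nat.Base as ℕ using (ℕ; zero; suc)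
import Data.Nat.Properties as ℕ
open import Data.Product.Base as Product using (Σ; ∃; ∃-syntax; _×_; _,_; proj₁; proj₂; uncurry)
open import Data.Product.Relation.Binary.Pointwise.NonDependent using (×-setoid)
open import Data.Sum.Base as Sum using (_⊎_; inj₁; inj₂; [_,_]′; map₂)
import Data.Sum.Properties as Sum
open import Data.Vec.Functional using (Vector; _∷_; insertAt)
import Data.Vec.Functional.Properties as Vector
open import Effect.Monad using (RawMonad)
open import Function.Base using (_∘_)
open import Function.Bundles using (Equivalence; _⇔_; mk⇔)
import Induction.WellFounded as WellFounded
open import Level using (_⊔_)
open import Relation.Binary.Construct.Closure.ReflexiveTransitive using (Star; ε; _◅_; _◅◅_)
open import Relation.Binary.Definitions using (Decidable; _Respects_)
open import Relation.Binary.PropositionalEquality as ≡ using (_≡_; _≢_)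
import Relation.Binary.Reasoning.Setoid
open import Relation.Binary.Structures using (IsDecTotalOrder)
open import Relation.Nullary using (¬_; Dec; yes; no; does; contradiction; ¬?)
open import Relation.Nullary.Decidable using (decidable-stable; ¬¬-excluded-middle; _×-dec_)
open import Relation.Nullary.Negation using (¬¬-Monad)

-- Indexing of the vertices and of the selected vertices of the corona.

Vertex : ℕ → ℕ → Set
Vertex n m = Fin n ⊎ Fin n × Fin m

module _ {n m : ℕ} where

  -- Has the body of `coronaVertex`, hence agrees with it by definition, but mentions no graphs:
  -- matrices and sums over the corona can be indexed before any graph is given.
  vertex : Fin (n ℕ.+ n ℕ.* m) → Vertex n m
  vertex x = map₂ (remQuot m) (splitAt n x)

  vertexIndex : Vertex n m → Fin (n ℕ.+ n ℕ.* m)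
  vertexIndex p = join n (n ℕ.* m) (map₂ (uncurry combine) p)

  vertex-vertexIndex : ∀ p → vertex (vertexIndex p) ≡ p
  vertex-vertexIndex (inj₁ i)       = ≡.cong (map₂ (remQuot m)) (Fin.splitAt-↑ˡ n i (n ℕ.* m))
  vertex-vertexIndex (inj₂ (i , a)) = ≡.trans
    (≡.cong (map₂ (remQuot m)) (Fin.splitAt-↑ʳ n (n ℕ.* m) (combine i a)))
    (≡.cong inj₂ (Fin.remQuot-combine i a))

  vertexIndex-vertex : ∀ x → vertexIndex (vertex x) ≡ x
  vertexIndex-vertex x with splitAt n x | Fin.join-splitAt n (n ℕ.* m) x
  ... | inj₁ _ | eq = eq
  ... | inj₂ y | eq = ≡.trans (≡.cong (n ↑ʳ_) (Fin.combine-remQuot {n} m y)) eq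

-- Indices of the selected vertices of the corona: those in the copies of H
-- come first, so that the component of a copy never contains the vertex of
-- G it is attached to.
module _ {n h g : ℕ} where

  selected : Fin (n ℕ.* h ℕ.+ g) → Fin n × Fin h ⊎ Fin g
  selected e = Sum.map₁ (remQuot h) (splitAt (n ℕ.* h) e)

  selectedIndex : Fin n × Fin h ⊎ Fin g → Fin (n ℕ.* h ℕ.+ g)
  selectedIndex x = join (n ℕ.* h) g (Sum.map₁ (uncurry combine) x)

  selected-selectedIndex : ∀ x → selected (selectedIndex x) ≡ x
  selected-selectedIndex (inj₁ (i , s)) = ≡.trans
    (≡.cong (Sum.map₁ (remQuot h)) (Fin.splitAt-↑ˡ (n ℕ.* h) (combine i s) g))
    (≡.cong inj₁ (Fin.remQuot-combine i s))
  selected-selectedIndex (inj₂ k)       = ≡.cong (Sum.map₁ (remQuot h)) (Fin.splitAt-↑ʳ (n ℕ.* h) g k)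

  selectedIndex-selected : ∀ e → selectedIndex (selected e) ≡ e
  selectedIndex-selected e with splitAt (n ℕ.* h) e | Fin.join-splitAt (n ℕ.* h) g e
  ... | inj₁ y | eq = ≡.trans (≡.cong (_↑ˡ g) (Fin.combine-remQuot {n} h y)) eq
  ... | inj₂ _ | eq = eq

  selectVertex : ∀ {m} → (Fin h → Fin m) → (Fin g → Fin n) → Fin n × Fin h ⊎ Fin g → Vertex n m
  selectVertex u v (inj₁ (i , s)) = inj₂ (i , u s)
  selectVertex u v (inj₂ k)       = inj₁ (v k)

  select : ∀ {m} → (Fin h → Fin m) → (Fin g → Fin n) → Fin (n ℕ.* h ℕ.+ g) → Fin (n ℕ.+ n ℕ.* m)
  select u v e = vertexIndex (selectVertex u v (selected e))

-- Components of the induced subgraphs.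

module _ {n r} (G : Graph n) (v : Fin r → Fin n) where
  open Graph G

  component-bounded : ∀ {k l} → InComponent G v k l → l Fin.≤ k
  component-bounded {k} = go ℕ.≤-refl
    where
    go : ∀ {a b} → a Fin.≤ k → Star (PrefixAdj G v k) a b → b Fin.≤ k
    go a≤k ε                   = a≤k
    go _   ((_ , b≤k , _) ◅ s) = go b≤k s

  -- A neighbour of the component at a position up to `k` lies in the same induced subgraph, so the
  -- path would extend to it. Edges leaving the component thus end at later positions, where
  -- coefficients are already known to vanish.
  component-cut : ∀ {k l l′} → InComponent G v k l → ¬ InComponent G v k l′ → Adj (v l) (v l′) → k Fin.< l′
  component-cut {k} {l} {l′} Ckl ¬Ckl′ adj with l′ Fin.≤? k
  ... | yes l′≤k = contradiction (Ckl ◅◅ (component-bounded Ckl , l′≤k , adj) ◅ ε) ¬Ckl′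
  ... | no  l′≰k = ℕ.≰⇒> l′≰k

-- Double negation commutes with finite conjunctions, so a predicate on `Fin n` may be assumed
-- decided whenever the goal is ¬¬-stable.
¬¬-decidable : ∀ {n p} (P : Fin n → Set p) → ¬ ¬ (∀ i → Dec (P i))
¬¬-decidable P = Fin.sequence (RawMonad.rawApplicative ¬¬-Monad) (λ _ → ¬¬-excluded-middle)

-- Axioms shared by the real and the complex scalars.

-- Lets ℝ and ℂ be treated at once. Positivity is a cone of self-conjugate elements rather than an
-- order, since ℂ has no compatible one.
record IsInvolutiveField {c ℓ₁ ℓ₂} (K : Scalars c ℓ₁ ℓ₂) : Set (c ⊔ ℓ₁ ⊔ ℓ₂) where
  open Scalars K
  infix 4 _≈?_
  field
    isCommutativeRing       : IsCommutativeRing _≈_ _+_ _*_ -_ 0# 1#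
    _≈?_                    : Decidable _≈_
    1≉0                     : ¬ (1# ≈ 0#)
    inverse                 : ∀ x → ¬ (x ≈ 0#) → ∃[ y ] x * y ≈ 1#
    conj-isRingHomomorphism : IsRingHomomorphism rawRing rawRing conj
    conj-involutive         : ∀ x → conj (conj x) ≈ x
    nonNegative-resp-≈      : NonNegative Respects _≈_
    nonNegative-+           : ∀ {x y} → NonNegative x → NonNegative y → NonNegative (x + y)
    nonNegative-*           : ∀ {x y} → NonNegative x → NonNegative y → NonNegative (x * y)
    nonNegative-norm        : ∀ x → NonNegative (conj x * x)
    nonNegative⇒conj≈       : ∀ {x} → NonNegative x → conj x ≈ x
    nonNegative-antisym     : ∀ {x} → NonNegative x → NonNegative (- x) → x ≈ 0#

-- Involutive fields, finite sums and the Kronecker delta.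

module LinearAlgebra {c ℓ₁ ℓ₂} (K : Scalars c ℓ₁ ℓ₂) (F : IsInvolutiveField K) where
  open Matrices K
  open Scalars K using (conj; NonNegative; rawRing)
  open IsInvolutiveField F hiding (isCommutativeRing)

  commutativeRing : CommutativeRing c ℓ₁
  commutativeRing = record { isCommutativeRing = IsInvolutiveField.isCommutativeRing F }

  open CommutativeRing commutativeRing hiding (rawRing; zero)
  open IsRingHomomorphism conj-isRingHomomorphism using ()
    renaming (⟦⟧-cong to conj-cong; +-homo to conj-+; *-homo to conj-*; 0#-homo to conj-0; 1#-homo to conj-1; -‿homo to conj-‿-)
  open Algebra.Properties.Semiring.Sum semiring
  open Algebra.Properties.Ring ring using (-‿distribʳ-*)
  open Algebra.Properties.Group +-group using (inverseʳ-unique; inverseˡ-unique; ∙-cancelˡ)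
  open Algebra.Solver.Ring.NaturalCoefficients.Default commutativeSemiring using (solve; _:=_; _:+_; _:*_)
  open Relation.Binary.Reasoning.Setoid setoid

  x*y≈0∧x≉0⇒y≈0 : ∀ {x y} → x * y ≈ 0# → ¬ (x ≈ 0#) → y ≈ 0#
  x*y≈0∧x≉0⇒y≈0 {x} {y} xy≈0 x≉0 = let z , xz≈1 = inverse x x≉0 in begin
    y             ≈⟨ *-identityˡ y ⟨
    1# * y        ≈⟨ *-congʳ xz≈1 ⟨
    (x * z) * y   ≈⟨ solve 3 (λ x y z → (x :* z) :* y := z :* (x :* y)) refl x y z ⟩
    z * (x * y)   ≈⟨ *-congˡ xy≈0 ⟩
    z * 0#        ≈⟨ zeroʳ z ⟩
    0#            ∎

  x*x≈0⇒x≈0 : ∀ {x} → x * x ≈ 0# → x ≈ 0#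
  x*x≈0⇒x≈0 {x} xx≈0 with x ≈? 0#
  ... | yes x≈0 = x≈0
  ... | no  x≉0 = x*y≈0∧x≉0⇒y≈0 xx≈0 x≉0

  conj≈0⇒≈0 : ∀ {x} → conj x ≈ 0# → x ≈ 0#
  conj≈0⇒≈0 {x} x̄≈0 = trans (sym (conj-involutive x)) (trans (conj-cong x̄≈0) conj-0)

  nonNegative-0 : NonNegative 0#
  nonNegative-0 = nonNegative-resp-≈ (zeroʳ _) (nonNegative-norm 0#)

  nonNegative-1 : NonNegative 1#
  nonNegative-1 = nonNegative-resp-≈ (trans (*-identityʳ _) conj-1) (nonNegative-norm 1#)

  nonNegative-sum : ∀ {n} {f : Vector Carrier n} → (∀ i → NonNegative (f i)) → NonNegative (sum f)
  nonNegative-sum {zero}  f≥0 = nonNegative-0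
  nonNegative-sum {suc n} f≥0 = nonNegative-+ (f≥0 zero) (nonNegative-sum (f≥0 ∘ suc))

  -- Here `y` equals `- x`, so both `x` and `- x` are nonnegative.
  x+y≈0⇒x≈0 : ∀ {x y} → NonNegative x → NonNegative y → x + y ≈ 0# → x ≈ 0#
  x+y≈0⇒x≈0 x≥0 y≥0 x+y≈0 =
    nonNegative-antisym x≥0 (nonNegative-resp-≈ (inverseʳ-unique _ _ x+y≈0) y≥0)

  nonNegative-sum≈0 : ∀ {n} {f : Vector Carrier n} → (∀ i → NonNegative (f i)) →
                      sum f ≈ 0# → ∀ i → f i ≈ 0#
  nonNegative-sum≈0 f≥0 Σf≈0 zero    = x+y≈0⇒x≈0 (f≥0 zero) (nonNegative-sum (f≥0 ∘ suc)) Σf≈0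
  nonNegative-sum≈0 f≥0 Σf≈0 (suc i) =
    nonNegative-sum≈0 (f≥0 ∘ suc) (x+y≈0⇒x≈0 (nonNegative-sum (f≥0 ∘ suc)) (f≥0 zero) (trans (+-comm _ _) Σf≈0)) i

  sum-zero : ∀ {n} {f : Vector Carrier n} → (∀ i → f i ≈ 0#) → sum f ≈ 0#
  sum-zero {n} f≈0 = trans (sum-cong-≋ f≈0) (sum-replicate-zero n)

  sum-single : ∀ {n} {f : Vector Carrier n} k → (∀ i → i ≢ k → f i ≈ 0#) → sum f ≈ f k
  sum-single {f = f} zero    f≈0 = trans (+-congˡ (sum-zero (λ i → f≈0 (suc i) (λ ())))) (+-identityʳ _)
  sum-single {f = f} (suc k) f≈0 =
    trans (+-cong (f≈0 zero (λ ())) (sum-single k (λ i i≢k → f≈0 (suc i) (i≢k ∘ Fin.suc-injective)))) (+-identityˡ _)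

  sum-linear : ∀ {n} (f x y : Vector Carrier n) a b →
               sum (λ j → f j * (a * x j + b * y j)) ≈ a * sum (λ j → f j * x j) + b * sum (λ j → f j * y j)
  sum-linear f x y a b = begin
    sum (λ j → f j * (a * x j + b * y j))
      ≈⟨ sum-cong-≋ (λ j → solve 5 (λ f x y a b → f :* (a :* x :+ b :* y) := a :* (f :* x) :+ b :* (f :* y)) refl (f j) (x j) (y j) a b) ⟩
    sum (λ j → a * (f j * x j) + b * (f j * y j))
      ≈⟨ ∑-distrib-+ (λ j → a * (f j * x j)) (λ j → b * (f j * y j)) ⟩
    sum (λ j → a * (f j * x j)) + sum (λ j → b * (f j * y j))
      ≈⟨ +-cong (*-distribˡ-sum a (λ j → f j * x j)) (*-distribˡ-sum b (λ j → f j * y j)) ⟨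
    a * sum (λ j → f j * x j) + b * sum (λ j → f j * y j) ∎

  sum-bilinear : ∀ {m n} (f : Vector Carrier m) (A : Fin m → Fin n → Carrier) (g : Vector Carrier n) →
                 sum (λ i → f i * sum (λ j → A i j * g j)) ≈ sum (λ j → sum (λ i → f i * A i j) * g j)
  sum-bilinear f A g = begin
    sum (λ i → f i * sum (λ j → A i j * g j))     ≈⟨ sum-cong-≋ (λ i → *-distribˡ-sum (f i) (λ j → A i j * g j)) ⟩
    sum (λ i → sum (λ j → f i * (A i j * g j)))   ≈⟨ ∑-comm (λ i j → f i * (A i j * g j)) ⟩
    sum (λ j → sum (λ i → f i * (A i j * g j)))   ≈⟨ sum-cong-≋ (λ j → sum-cong-≋ (λ i → sym (*-assoc (f i) (A i j) (g j)))) ⟩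
    sum (λ j → sum (λ i → f i * A i j * g j))     ≈⟨ sum-cong-≋ (λ j → sym (*-distribʳ-sum (g j) (λ i → f i * A i j))) ⟩
    sum (λ j → sum (λ i → f i * A i j) * g j)     ∎

  δ : ∀ {n} → Fin n → Fin n → Carrier
  δ i j = if does (i Fin.≟ j) then 1# else 0#

  δ-refl : ∀ {n} (i : Fin n) → δ i i ≈ 1#
  δ-refl i with i Fin.≟ i
  ... | yes _   = refl
  ... | no  i≢i = contradiction ≡.refl i≢i

  δ-≢ : ∀ {n} {i j : Fin n} → i ≢ j → δ i j ≈ 0#
  δ-≢ {i = i} {j} i≢j with i Fin.≟ j
  ... | yes i≡j = contradiction i≡j i≢j
  ... | no  _   = refl

  δ-comm : ∀ {n} (i j : Fin n) → δ i j ≈ δ j i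
  δ-comm i j with i Fin.≟ j
  ... | yes ≡.refl = sym (δ-refl i)
  ... | no  i≢j    = sym (δ-≢ (i≢j ∘ ≡.sym))

  conj-δ : ∀ {n} (i j : Fin n) → conj (δ i j) ≈ δ i j
  conj-δ i j with i Fin.≟ j
  ... | yes _ = conj-1
  ... | no  _ = conj-0

  sum-δ : ∀ {n} (i : Fin n) (f : Vector Carrier n) → sum (λ j → δ i j * f j) ≈ f i
  sum-δ i f = begin
    sum (λ j → δ i j * f j)   ≈⟨ sum-single i (λ j j≢i → trans (*-congʳ (δ-≢ (j≢i ∘ ≡.sym))) (zeroˡ _)) ⟩
    δ i i * f i               ≈⟨ *-congʳ (δ-refl i) ⟩
    1# * f i                  ≈⟨ *-identityˡ _ ⟩
    f i                       ∎

  conj-sum : ∀ {n} (f : Vector Carrier n) → conj (sum f) ≈ sum (conj ∘ f)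
  conj-sum {zero}  f = conj-0
  conj-sum {suc n} f = trans (conj-+ _ _) (+-congˡ (conj-sum (f ∘ suc)))

  -- The Hermitian inner product and positive semidefinite matrices.

  infixl 8 _*ᵥ_
  _*ᵥ_ : ∀ {m n} → (Fin m → Fin n → Carrier) → Vector Carrier n → Vector Carrier m
  (A *ᵥ x) i = sum λ j → A i j * x j

  ⟨_,_⟩ : ∀ {n} → Vector Carrier n → Vector Carrier n → Carrier
  ⟨ x , y ⟩ = sum λ i → conj (x i) * y i

  ⟨⟩-cong : ∀ {n} {x x′ y y′ : Vector Carrier n} → (∀ i → x i ≈ x′ i) → (∀ i → y i ≈ y′ i) → ⟨ x , y ⟩ ≈ ⟨ x′ , y′ ⟩
  ⟨⟩-cong x≈x′ y≈y′ = sum-cong-≋ λ i → *-cong (conj-cong (x≈x′ i)) (y≈y′ i)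

  ⟨⟩-zeroʳ : ∀ {n} (x : Vector Carrier n) {y} → (∀ i → y i ≈ 0#) → ⟨ x , y ⟩ ≈ 0#
  ⟨⟩-zeroʳ x y≈0 = sum-zero λ i → trans (*-congˡ (y≈0 i)) (zeroʳ _)

  ⟨⟩-conj : ∀ {n} (x y : Vector Carrier n) → conj ⟨ x , y ⟩ ≈ ⟨ y , x ⟩
  ⟨⟩-conj x y = trans (conj-sum (λ i → conj (x i) * y i)) (sum-cong-≋ λ i → begin
    conj (conj (x i) * y i)          ≈⟨ conj-* _ _ ⟩
    conj (conj (x i)) * conj (y i)   ≈⟨ *-congʳ (conj-involutive _) ⟩
    x i * conj (y i)                 ≈⟨ *-comm _ _ ⟩
    conj (y i) * x i                 ∎)

  ⟨⟩-linearʳ : ∀ {n} (x y z : Vector Carrier n) a b →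
               ⟨ x , (λ i → a * y i + b * z i) ⟩ ≈ a * ⟨ x , y ⟩ + b * ⟨ x , z ⟩
  ⟨⟩-linearʳ x y z a b = sum-linear (conj ∘ x) y z a b

  ⟨⟩-linearˡ : ∀ {n} (x y z : Vector Carrier n) a b →
               ⟨ (λ i → a * x i + b * y i) , z ⟩ ≈ conj a * ⟨ x , z ⟩ + conj b * ⟨ y , z ⟩
  ⟨⟩-linearˡ x y z a b = begin
    ⟨ (λ i → a * x i + b * y i) , z ⟩                  ≈⟨ ⟨⟩-conj z _ ⟨
    conj ⟨ z , (λ i → a * x i + b * y i) ⟩             ≈⟨ conj-cong (⟨⟩-linearʳ z x y a b) ⟩
    conj (a * ⟨ z , x ⟩ + b * ⟨ z , y ⟩)               ≈⟨ conj-+ _ _ ⟩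
    conj (a * ⟨ z , x ⟩) + conj (b * ⟨ z , y ⟩)        ≈⟨ +-cong (conj-* _ _) (conj-* _ _) ⟩
    conj a * conj ⟨ z , x ⟩ + conj b * conj ⟨ z , y ⟩  ≈⟨ +-cong (*-congˡ (⟨⟩-conj z x)) (*-congˡ (⟨⟩-conj z y)) ⟩
    conj a * ⟨ x , z ⟩ + conj b * ⟨ y , z ⟩            ∎

  nonNegative-⟨⟩ : ∀ {n} (x : Vector Carrier n) → NonNegative ⟨ x , x ⟩
  nonNegative-⟨⟩ x = nonNegative-sum (nonNegative-norm ∘ x)

  norm≈0⇒≈0 : ∀ {x} → conj x * x ≈ 0# → x ≈ 0#
  norm≈0⇒≈0 {x} x̄x≈0 with x ≈? 0#
  ... | yes x≈0 = x≈0
  ... | no  x≉0 = conj≈0⇒≈0 (x*y≈0∧x≉0⇒y≈0 (trans (*-comm _ _) x̄x≈0) x≉0)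

  ⟨⟩-definite : ∀ {n} {x : Vector Carrier n} → ⟨ x , x ⟩ ≈ 0# → ∀ i → x i ≈ 0#
  ⟨⟩-definite {x = x} xx≈0 i = norm≈0⇒≈0 (nonNegative-sum≈0 (nonNegative-norm ∘ x) xx≈0 i)

  hermitian-row : ∀ {n} {A : Matrix n} → IsHermitian A → ∀ x j → sum (λ i → conj (x i) * A i j) ≈ conj ((A *ᵥ x) j)
  hermitian-row {A = A} herm x j = begin
    sum (λ i → conj (x i) * A i j)          ≈⟨ sum-cong-≋ (λ i → *-congˡ (herm i j)) ⟩
    sum (λ i → conj (x i) * conj (A j i))   ≈⟨ sum-cong-≋ (λ i → trans (*-comm _ _) (sym (conj-* (A j i) (x i)))) ⟩
    sum (λ i → conj (A j i * x i))          ≈⟨ conj-sum (λ i → A j i * x i) ⟨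
    conj ((A *ᵥ x) j)                       ∎

  ⟨⟩-adjoint : ∀ {n} {A : Matrix n} → IsHermitian A → ∀ x y → ⟨ x , A *ᵥ y ⟩ ≈ ⟨ A *ᵥ x , y ⟩
  ⟨⟩-adjoint {A = A} herm x y =
    trans (sum-bilinear (conj ∘ x) A y) (sum-cong-≋ λ j → *-congʳ (hermitian-row herm x j))

  quadraticForm : ∀ {n} (A : Matrix n) x → sum (λ i → sum λ j → conj (x i) * A i j * x j) ≈ ⟨ x , A *ᵥ x ⟩
  quadraticForm A x = sum-cong-≋ λ i → sym (trans (*-distribˡ-sum (conj (x i)) (λ j → A i j * x j))
    (sum-cong-≋ λ j → sym (*-assoc (conj (x i)) (A i j) (x j))))

  psd-nonNegative : ∀ {n} {A : Matrix n} → IsPositiveSemidefinite A → ∀ x → NonNegative ⟨ x , A *ᵥ x ⟩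
  psd-nonNegative {A = A} (_ , psd) x = nonNegative-resp-≈ (quadraticForm A x) (psd x)

  -- With b = A x, p = ⟨b , b⟩ and q = ⟨b , A b⟩, the form takes the value
  -- − p²(q + 2) at (q + 1) x − p b.
  psd-kernel : ∀ {n} {A : Matrix n} → IsPositiveSemidefinite A → ∀ x → ⟨ x , A *ᵥ x ⟩ ≈ 0# →
               ∀ i → (A *ᵥ x) i ≈ 0#
  psd-kernel {n} {A} psd@(herm , _) x xAx≈0 = ⟨⟩-definite p≈0
    where
    b = A *ᵥ x
    p = ⟨ b , b ⟩
    q = ⟨ b , A *ᵥ b ⟩
    l = q + 1#
    m = - p
    p≥0 : NonNegative p
    p≥0 = nonNegative-⟨⟩ b
    q≥0 : NonNegative q
    q≥0 = psd-nonNegative psd b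
    z : Vector Carrier n
    z i = l * x i + m * b i
    conj-l : conj l ≈ l
    conj-l = nonNegative⇒conj≈ (nonNegative-+ q≥0 nonNegative-1)
    conj-m : conj m ≈ m
    conj-m = trans (conj-‿- p) (-‿cong (nonNegative⇒conj≈ p≥0))
    value : ⟨ z , A *ᵥ z ⟩ ≈ l * (l * 0# + m * p) + m * (l * p + m * q)
    value = begin
      ⟨ z , A *ᵥ z ⟩
        ≈⟨ ⟨⟩-cong (λ _ → refl) (λ i → sum-linear (A i) x b l m) ⟩
      ⟨ z , (λ i → l * b i + m * (A *ᵥ b) i) ⟩
        ≈⟨ ⟨⟩-linearˡ x b _ l m ⟩
      conj l * ⟨ x , (λ i → l * b i + m * (A *ᵥ b) i) ⟩ + conj m * ⟨ b , (λ i → l * b i + m * (A *ᵥ b) i) ⟩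
        ≈⟨ +-cong (*-cong conj-l (⟨⟩-linearʳ x b _ l m)) (*-cong conj-m (⟨⟩-linearʳ b b _ l m)) ⟩
      l * (l * ⟨ x , b ⟩ + m * ⟨ x , A *ᵥ b ⟩) + m * (l * p + m * q)
        ≈⟨ +-congʳ (*-congˡ (+-cong (*-congˡ xAx≈0) (*-congˡ (⟨⟩-adjoint herm x b)))) ⟩
      l * (l * 0# + m * p) + m * (l * p + m * q) ∎
    -- The solver knows only semirings, so `m` stands for `- p` as a variable and the factor `p + m`
    -- is split off. One `p * p` is kept apart so that a vanishing sum of nonnegative terms gives
    -- `p * p ≈ 0#` without a division by q + 2.
    value+ : p * p + (p * p * q + p * p) + ⟨ z , A *ᵥ z ⟩ ≈ 0#
    value+ = begin
      p * p + (p * p * q + p * p) + ⟨ z , A *ᵥ z ⟩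
        ≈⟨ +-congˡ (trans value (+-congʳ (*-congˡ (trans (+-congʳ (zeroʳ l)) (+-identityˡ _))))) ⟩
      p * p + (p * p * q + p * p) + (l * (m * p) + m * (l * p + m * q))
        ≈⟨ +-congˡ (solve 4 (λ p q m e → (q :+ e) :* (m :* p) :+ m :* ((q :+ e) :* p :+ m :* q)
             := q :* (m :* p) :+ (e :* m) :* p :+ m :* (q :* p :+ m :* q) :+ (e :* m) :* p) refl p q m 1#) ⟩
      p * p + (p * p * q + p * p) + (q * (m * p) + (1# * m) * p + m * (q * p + m * q) + (1# * m) * p)
        ≈⟨ +-congˡ (+-cong (+-congʳ (+-congˡ (*-congʳ (*-identityˡ m)))) (*-congʳ (*-identityˡ m))) ⟩
      p * p + (p * p * q + p * p) + (q * (m * p) + m * p + m * (q * p + m * q) + m * p)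
        ≈⟨ solve 3 (λ p q m → p :* p :+ (p :* p :* q :+ p :* p) :+ (q :* (m :* p) :+ m :* p :+ m :* (q :* p :+ m :* q) :+ m :* p)
             := (p :+ m) :* (q :* (p :+ m) :+ p :+ p)) refl p q m ⟩
      (p + m) * (q * (p + m) + p + p)
        ≈⟨ *-congʳ (-‿inverseʳ p) ⟩
      0# * (q * (p + m) + p + p)
        ≈⟨ zeroˡ _ ⟩
      0# ∎
    pp≥0 = nonNegative-* p≥0 p≥0
    p≈0 : p ≈ 0#
    p≈0 = x*x≈0⇒x≈0 (x+y≈0⇒x≈0 pp≥0
            (nonNegative-+ (nonNegative-+ (nonNegative-* pp≥0 q≥0) pp≥0) (psd-nonNegative psd z))
            (trans (sym (+-assoc _ _ _)) value+))

  -- Rank and determining rows.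

  -- Over a field this says that the rows `ρ` span the row space. As a bound on the rank it needs no
  -- basis and passes directly to block constructions such as the corona matrix.
  IsDetermining : ∀ {n d} → Matrix n → (Fin d → Fin n) → Set (c ⊔ ℓ₁)
  IsDetermining A ρ = ∀ x → (∀ e → (A *ᵥ x) (ρ e) ≈ 0#) → ∀ i → (A *ᵥ x) i ≈ 0#

  *ᵥ-insertAt : ∀ {d k} (A : Fin d → Fin (suc k) → Carrier) (x : Vector Carrier k) p t i →
                (A *ᵥ insertAt x p t) i ≈ A i p * t + sum (λ j → A i (punchIn p j) * x j)
  *ᵥ-insertAt A x p t i = trans (sum-remove {i = p} (λ j → A i j * insertAt x p t j))
    (+-cong (*-congˡ (reflexive (Vector.insertAt-lookup x p t)))
            (sum-cong-≋ λ j → *-congˡ {A i (punchIn p j)} (reflexive (Vector.insertAt-punchIn x p t j))))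

  -- Gaussian elimination, by induction on the number of equations. A zero first row is dropped;
  -- otherwise a pivot `p` is eliminated from the other rows, which costs one equation and one
  -- unknown.
  homogeneousSystem : ∀ {d k} (A : Fin d → Fin k → Carrier) → d ℕ.< k →
                      ∃[ x ] (∀ i → (A *ᵥ x) i ≈ 0#) × ∃[ j ] ¬ (x j ≈ 0#)
  homogeneousSystem {zero}  {suc k} A _ = (λ _ → 1#) , (λ ()) , zero , 1≉0
  homogeneousSystem {suc d} {suc k} A (ℕ.s≤s d<k) with Fin.any? (λ j → ¬? (A zero j ≈? 0#))
  ... | no A₀≈0 =
    let x , Ax≈0 , x≉0 = homogeneousSystem (A ∘ suc) (ℕ.m<n⇒m<1+n d<k) in
    x , (λ { zero    → sum-zero λ j → trans (*-congʳ (decidable-stable (A zero j ≈? 0#) (λ A₀ⱼ≉0 → A₀≈0 (j , A₀ⱼ≉0)))) (zeroˡ (x j))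
           ; (suc i) → Ax≈0 i })
      , x≉0
  ... | yes (p , A₀ₚ≉0) = eliminate (homogeneousSystem A′ d<k)
    where
    -- Minus the inverse of the pivot: `w * S` below is the value of the unknown `p` that solves the
    -- first equation.
    w = - proj₁ (inverse (A zero p) A₀ₚ≉0)
    A₀ₚw+1≈0 : A zero p * w + 1# ≈ 0#
    A₀ₚw+1≈0 = trans (+-congʳ (trans (sym (-‿distribʳ-* _ _)) (-‿cong (proj₂ (inverse (A zero p) A₀ₚ≉0))))) (-‿inverseˡ 1#)
    A′ : Fin d → Fin k → Carrier
    A′ i j = A (suc i) (punchIn p j) + (A (suc i) p * w) * A zero (punchIn p j)
    eliminate : ∃[ x ] (∀ i → (A′ *ᵥ x) i ≈ 0#) × ∃[ j ] ¬ (x j ≈ 0#) →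
                ∃[ x ] (∀ i → (A *ᵥ x) i ≈ 0#) × ∃[ j ] ¬ (x j ≈ 0#)
    eliminate (x , A′x≈0 , j , xⱼ≉0) =
      insertAt x p (w * S) , Ax≈0 , punchIn p j , (λ e → xⱼ≉0 (trans (sym (reflexive (Vector.insertAt-punchIn x p (w * S) j))) e))
      where
      S = sum (λ j → A zero (punchIn p j) * x j)
      Ax≈0 : ∀ i → (A *ᵥ insertAt x p (w * S)) i ≈ 0#
      Ax≈0 zero = begin
        (A *ᵥ insertAt x p (w * S)) zero     ≈⟨ *ᵥ-insertAt A x p (w * S) zero ⟩
        A zero p * (w * S) + S               ≈⟨ +-cong (*-assoc _ _ _) (*-identityˡ S) ⟨
        (A zero p * w) * S + 1# * S          ≈⟨ distribʳ _ _ _ ⟨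
        (A zero p * w + 1#) * S              ≈⟨ *-congʳ A₀ₚw+1≈0 ⟩
        0# * S                               ≈⟨ zeroˡ S ⟩
        0#                                   ∎
      Ax≈0 (suc i) = begin
        (A *ᵥ insertAt x p (w * S)) (suc i)
          ≈⟨ *ᵥ-insertAt A x p (w * S) (suc i) ⟩
        A (suc i) p * (w * S) + T
          ≈⟨ trans (+-comm _ _) (+-cong (sym (*-identityˡ T)) (sym (*-assoc _ _ _))) ⟩
        1# * T + (A (suc i) p * w) * S
          ≈⟨ +-cong (*-congˡ (sum-cong-≋ λ j → *-comm (A (suc i) (punchIn p j)) (x j)))
                    (*-congˡ (sum-cong-≋ λ j → *-comm (A zero (punchIn p j)) (x j))) ⟩
        1# * sum (λ j → x j * A (suc i) (punchIn p j)) + (A (suc i) p * w) * sum (λ j → x j * A zero (punchIn p j))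
          ≈⟨ sum-linear x (λ j → A (suc i) (punchIn p j)) (λ j → A zero (punchIn p j)) 1# (A (suc i) p * w) ⟨
        sum (λ j → x j * (1# * A (suc i) (punchIn p j) + (A (suc i) p * w) * A zero (punchIn p j)))
          ≈⟨ sum-cong-≋ (λ j → trans (*-comm (x j) _) (*-congʳ (+-congʳ (*-identityˡ (A (suc i) (punchIn p j)))))) ⟩
        (A′ *ᵥ x) i
          ≈⟨ A′x≈0 i ⟩
        0# ∎
        where T = sum (λ j → A (suc i) (punchIn p j) * x j)

  -- Built so that `A *ᵥ scatter σ a` is the combination of the columns `σ` of `A` with coefficients
  -- `a`; contributions at a repeated index add up.
  scatter : ∀ {k n} → (Fin k → Fin n) → Vector Carrier k → Vector Carrier n
  scatter σ a q = sum λ e → δ (σ e) q * a e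

  sum-scatter : ∀ {k n} (σ : Fin k → Fin n) a (f : Vector Carrier n) →
                sum (λ q → f q * scatter σ a q) ≈ sum (λ e → f (σ e) * a e)
  sum-scatter σ a f = trans (sum-bilinear f (λ q e → δ (σ e) q) a)
    (sum-cong-≋ λ e → *-congʳ (trans (sum-cong-≋ λ q → *-comm (f q) (δ (σ e) q)) (sum-δ (σ e) f)))

  -- More than `d` columns satisfy a nontrivial relation on the `d` rows `ρ`, and `det` extends it
  -- to all rows.
  determining⇒rank≤ : ∀ {n d} {A : Matrix n} {ρ : Fin d → Fin n} → IsDetermining A ρ →
                      ∀ {k} (σ : Fin k → Fin n) → LinearlyIndependent (λ j i → A i (σ j)) → k ℕ.≤ d
  determining⇒rank≤ {d = d} {A} {ρ} det {k} σ indep = ℕ.≮⇒≥ λ d<k →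
    let a , Ba≈0 , j , aⱼ≉0 = homogeneousSystem (λ e j → A (ρ e) (σ j)) d<k in
    aⱼ≉0 (indep a (λ i → begin
      sum (λ j → a j * A i (σ j))     ≈⟨ sum-cong-≋ (λ j → *-comm (a j) (A i (σ j))) ⟩
      sum (λ j → A i (σ j) * a j)     ≈⟨ sum-scatter σ a (A i) ⟨
      (A *ᵥ scatter σ a) i            ≈⟨ det (scatter σ a) (λ e → trans (sum-scatter σ a (A (ρ e))) (Ba≈0 e)) i ⟩
      0#                              ∎) j)

  -- If A x vanished on the rows σ but not at p, then pairing a relation
  -- between the columns p ∷ σ with x would show that p has coefficient 0,
  -- so p ∷ σ would be independent, against the maximality of r.
  hermitian-rank⇒determining : ∀ {n r} {A : Matrix n} → IsHermitian A → IsRank A r → Σ (Fin r → Fin n) (IsDetermining A)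
  hermitian-rank⇒determining {n} {r} {A} herm ((σ , indep) , maximal) = σ , det
    where
    det : IsDetermining A σ
    det x Axσ≈0 p = decidable-stable ((A *ᵥ x) p ≈? 0#) λ Axₚ≉0 →
      ℕ.1+n≰n (maximal (suc r) (p ∷ σ , independent Axₚ≉0))
      where
      independent : ¬ ((A *ᵥ x) p ≈ 0#) → LinearlyIndependent (λ j i → A i ((p ∷ σ) j))
      independent Axₚ≉0 a rel = λ { zero → a₀≈0 ; (suc j) → indep (a ∘ suc) relσ j }
        where
        paired : sum (λ j → conj ((A *ᵥ x) ((p ∷ σ) j)) * a j) ≈ 0#
        paired = begin
          sum (λ j → conj ((A *ᵥ x) ((p ∷ σ) j)) * a j)
            ≈⟨ sum-cong-≋ (λ j → *-congʳ {a j} (hermitian-row herm x ((p ∷ σ) j))) ⟨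
          sum (λ j → sum (λ i → conj (x i) * A i ((p ∷ σ) j)) * a j)
            ≈⟨ sum-bilinear (conj ∘ x) (λ i j → A i ((p ∷ σ) j)) a ⟨
          sum (λ i → conj (x i) * sum (λ j → A i ((p ∷ σ) j) * a j))
            ≈⟨ ⟨⟩-zeroʳ x (λ i → trans (sum-cong-≋ (λ j → *-comm (A i ((p ∷ σ) j)) (a j))) (rel i)) ⟩
          0# ∎
        a₀≈0 : a zero ≈ 0#
        a₀≈0 = x*y≈0∧x≉0⇒y≈0
          (trans (sym (sum-single {f = λ j → conj ((A *ᵥ x) ((p ∷ σ) j)) * a j} zero
            λ { zero    0≢0 → contradiction ≡.refl 0≢0
              ; (suc j) _   → trans (*-congʳ (trans (conj-cong (Axσ≈0 j)) conj-0)) (zeroˡ _) })) paired)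
          (Axₚ≉0 ∘ conj≈0⇒≈0)
        relσ : ∀ i → sum (λ j → a (suc j) * A i (σ j)) ≈ 0#
        relσ i = trans (sym (trans (+-congʳ (trans (*-congʳ a₀≈0) (zeroˡ _))) (+-identityˡ _))) (rel i)

  -- Vectors outside finitely many hyperplanes.

  fromℕ : ℕ → Carrier
  fromℕ zero    = 0#
  fromℕ (suc n) = 1# + fromℕ n

  fromℕ-nonNegative : ∀ n → NonNegative (fromℕ n)
  fromℕ-nonNegative zero    = nonNegative-0
  fromℕ-nonNegative (suc n) = nonNegative-+ nonNegative-1 (fromℕ-nonNegative n)

  -- Characteristic 0: a sum of nonnegative elements, one of which is `1#`, cannot vanish.
  fromℕ-< : ∀ {m n} → m ℕ.< n → ¬ (fromℕ m ≈ fromℕ n)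
  fromℕ-< {zero}  {suc n} _           0≈1+n   = 1≉0 (x+y≈0⇒x≈0 nonNegative-1 (fromℕ-nonNegative n) (sym 0≈1+n))
  fromℕ-< {suc m} {suc n} (ℕ.s≤s m<n) 1+m≈1+n = fromℕ-< m<n (∙-cancelˡ 1# _ _ 1+m≈1+n)

  *-cancelʳ : ∀ {x y z} → ¬ (z ≈ 0#) → x * z ≈ y * z → x ≈ y
  *-cancelʳ {x} {y} {z} z≉0 xz≈yz = let v , zv≈1 = inverse z z≉0 in begin
    x            ≈⟨ trans (*-congˡ zv≈1) (*-identityʳ x) ⟨
    x * (z * v)  ≈⟨ *-assoc _ _ _ ⟨
    x * z * v    ≈⟨ *-congʳ xz≈yz ⟩
    y * z * v    ≈⟨ *-assoc _ _ _ ⟩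
    y * (z * v)  ≈⟨ trans (*-congˡ zv≈1) (*-identityʳ y) ⟩
    y            ∎

  -- Each affine function of `t` has a single root. If all of 0, ..., `k` were roots, two of them
  -- would by pigeonhole be roots of the same function.
  avoidRoots : ∀ {k} (a b : Vector Carrier k) → (∀ i → ¬ (a i ≈ 0#)) → ∃[ t ] (∀ i → ¬ (t * a i + b i ≈ 0#))
  avoidRoots {k} a b a≉0 with Fin.any? {suc k} (λ t → Fin.all? (λ i → ¬? (fromℕ (Fin.toℕ t) * a i + b i ≈? 0#)))
  ... | yes (t , avoids) = fromℕ (Fin.toℕ t) , avoids
  ... | no  hits =
    let t , t′ , t<t′ , i≡i′ = Fin.pigeonhole (ℕ.n<1+n k) (proj₁ ∘ root) in
    contradiction (*-cancelʳ (a≉0 _) (trans (inverseˡ-unique _ _ (proj₂ (root t)))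
                    (sym (inverseˡ-unique _ _ (≡.subst (λ i → fromℕ (Fin.toℕ t′) * a i + b i ≈ 0#) (≡.sym i≡i′) (proj₂ (root t′)))))))
                  (fromℕ-< t<t′)
    where
    root : ∀ t → ∃[ i ] fromℕ (Fin.toℕ t) * a i + b i ≈ 0#
    root t with Fin.any? (λ i → fromℕ (Fin.toℕ t) * a i + b i ≈? 0#)
    ... | yes found = found
    ... | no  none  = contradiction (t , λ i e → none (i , e)) hits

  -- Induction on the rows. If the vector `y` found for the later rows annihilates the first one, it
  -- becomes `t` times `y` plus a unit vector at a nonzero entry of the first row. That row is then
  -- nonzero for every `t`, and `avoidRoots` picks a `t` that suits the others.
  genericVector : ∀ {k n} (A : Fin k → Fin n → Carrier) → (∀ i → ∃[ j ] ¬ (A i j ≈ 0#)) →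
                  ∃[ y ] (∀ i → ¬ ((A *ᵥ y) i ≈ 0#))
  genericVector {zero}  A A≉0 = (λ _ → 0#) , λ ()
  genericVector {suc k} A A≉0 with genericVector (A ∘ suc) (A≉0 ∘ suc)
  ... | y , Ay≉0 with (A *ᵥ y) zero ≈? 0#
  ... | no  A₀y≉0 = y , λ { zero → A₀y≉0 ; (suc i) → Ay≉0 i }
  ... | yes A₀y≈0 = let t , avoids = avoidRoots (((A ∘ suc) *ᵥ y)) (λ i → A (suc i) b) Ay≉0 in
    (λ j → t * y j + 1# * δ b j) ,
    λ { zero    e → proj₂ (A≉0 zero) (trans (sym (trans (value t zero) (trans (+-congʳ (trans (*-congˡ A₀y≈0) (zeroʳ t))) (+-identityˡ _)))) e)
      ; (suc i) e → avoids i (trans (sym (value t (suc i))) e) }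
    where
    b = proj₁ (A≉0 zero)
    value : ∀ t i → (A *ᵥ (λ j → t * y j + 1# * δ b j)) i ≈ t * (A *ᵥ y) i + A i b
    value t i = trans (sum-linear (A i) y (δ b) t 1#)
      (+-congˡ (trans (*-identityˡ _) (trans (sum-cong-≋ (λ j → *-comm (A i j) (δ b j))) (sum-δ b (A i)))))

  -- Relations between columns of a positive semidefinite matrix.

  -- The part u of the relation a supported on C satisfies u* A u = 0,
  -- hence A u = 0, and row w of A u is A w (σ k) * a k.
  separatedCoefficient :
    ∀ {n r} {A : Matrix n} → IsPositiveSemidefinite A →
    (σ : Fin r → Fin n) (a : Vector Carrier r) → (∀ i → sum (λ e → a e * A i (σ e)) ≈ 0#) →
    ∀ {p} {C : Fin r → Set p} → (∀ e → Dec (C e)) →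
    (∀ {e e′} → C e → ¬ C e′ → A (σ e) (σ e′) ≈ 0# ⊎ a e′ ≈ 0#) →
    ∀ {k} w → C k → ¬ (A w (σ k) ≈ 0#) →
    (∀ {e} → C e → e ≢ k → A w (σ e) ≈ 0# ⊎ a e ≈ 0#) →
    a k ≈ 0#
  separatedCoefficient {n} {r} {A} psd σ a rel {C = C} C? cut {k} w Ck Awk≉0 Aw = aₖ≈0
    where
    u : Vector Carrier r
    u e = if does (C? e) then a e else 0#
    u≈a : ∀ {e} → C e → u e ≈ a e
    u≈a {e} Ce with C? e
    ... | yes _  = refl
    ... | no ¬Ce = contradiction Ce ¬Ce
    Ax : ∀ i → (A *ᵥ scatter σ u) i ≈ sum (λ e → A i (σ e) * u e)
    Ax i = sum-scatter σ u (A i)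
    -- In a row belonging to `C`, the terms of the relation outside `C` vanish by `cut`, so
    -- replacing `a` by `u` changes nothing and `A` times the scattered `u` is 0 there.
    term : ∀ e e′ → C e → A (σ e) (σ e′) * u e′ ≈ a e′ * A (σ e) (σ e′)
    term e e′ Ce with C? e′
    ... | yes _   = *-comm _ _
    ... | no ¬Ce′ with cut Ce ¬Ce′
    ...   | inj₁ A≈0 = trans (zeroʳ _) (sym (trans (*-congˡ A≈0) (zeroʳ _)))
    ...   | inj₂ a≈0 = trans (zeroʳ _) (sym (trans (*-congʳ a≈0) (zeroˡ _)))
    entry : ∀ e → conj ((A *ᵥ scatter σ u) (σ e)) * u e ≈ 0#
    entry e with C? e
    ... | no  _  = zeroʳ _
    ... | yes Ce = trans (*-congʳ (trans (conj-cong (trans (Ax (σ e)) (trans (sum-cong-≋ (λ e′ → term e e′ Ce)) (rel (σ e))))) conj-0)) (zeroˡ _)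
    -- Conjugation puts the scattered vector on the right, where `sum-scatter` reduces the form to
    -- the selected rows; in these either `u` vanishes or the row does.
    Ax≈0 : ∀ i → (A *ᵥ scatter σ u) i ≈ 0#
    Ax≈0 = psd-kernel psd (scatter σ u) (begin
      ⟨ scatter σ u , A *ᵥ scatter σ u ⟩
        ≈⟨ ⟨⟩-conj (A *ᵥ scatter σ u) (scatter σ u) ⟨
      conj ⟨ A *ᵥ scatter σ u , scatter σ u ⟩
        ≈⟨ conj-cong (trans (sum-scatter σ u (λ q → conj ((A *ᵥ scatter σ u) q))) (sum-zero entry)) ⟩
      conj 0#
        ≈⟨ conj-0 ⟩
      0# ∎)
    single : ∀ e → e ≢ k → A w (σ e) * u e ≈ 0#
    single e e≢k with C? e
    ... | no  _  = zeroʳ _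
    ... | yes Ce with Aw Ce e≢k
    ...   | inj₁ A≈0 = trans (*-congʳ A≈0) (zeroˡ _)
    ...   | inj₂ a≈0 = trans (*-congˡ a≈0) (zeroʳ _)
    aₖ≈0 : a k ≈ 0#
    aₖ≈0 = x*y≈0∧x≉0⇒y≈0 (begin
      A w (σ k) * a k                     ≈⟨ *-congˡ (u≈a Ck) ⟨
      A w (σ k) * u k                     ≈⟨ sum-single k single ⟨
      sum (λ e → A w (σ e) * u e)         ≈⟨ Ax w ⟨
      (A *ᵥ scatter σ u) w                ≈⟨ Ax≈0 w ⟩
      0#                                  ∎) Awk≉0

  -- Sums over the vertices of the corona.

  sum-splitAt : ∀ m {n} (f : Fin m ⊎ Fin n → Carrier) → sum (f ∘ splitAt m) ≈ sum (f ∘ inj₁) + sum (f ∘ inj₂)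
  sum-splitAt zero    f = sym (+-identityˡ _)
  sum-splitAt (suc m) f = trans (+-congˡ (sum-splitAt m (f ∘ Sum.map₁ suc))) (sym (+-assoc _ _ _))

  sum-remQuot : ∀ n {m} (f : Fin n × Fin m → Carrier) → sum (f ∘ remQuot {n} m) ≈ sum (λ i → sum (λ a → f (i , a)))
  sum-remQuot zero        f = refl
  sum-remQuot (suc n) {m} f = begin
    sum (f ∘ remQuot {suc n} m)
      ≈⟨ sum-cong-≋ (reflexive ∘ ≡.cong f ∘ remQuot-suc) ⟩
    sum (f ∘ [ (zero ,_) , Product.map₁ suc ∘ remQuot {n} m ]′ ∘ splitAt m)
      ≈⟨ sum-splitAt m (f ∘ [ (zero ,_) , Product.map₁ suc ∘ remQuot {n} m ]′) ⟩
    sum (λ a → f (zero , a)) + sum (f ∘ Product.map₁ suc ∘ remQuot {n} m)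
      ≈⟨ +-congˡ (sum-remQuot n (f ∘ Product.map₁ suc)) ⟩
    sum (λ i → sum (λ a → f (i , a))) ∎
    where
    remQuot-suc : ∀ x → remQuot {suc n} m x ≡ [ (zero ,_) , Product.map₁ suc ∘ remQuot {n} m ]′ (splitAt m x)
    remQuot-suc x with splitAt m x
    ... | inj₁ _ = ≡.refl
    ... | inj₂ _ = ≡.refl

  sum-vertex : ∀ {n m} (f : Vertex n m → Carrier) →
               sum (f ∘ vertex) ≈ sum (f ∘ inj₁) + sum (λ i → sum (λ a → f (inj₂ (i , a))))
  sum-vertex {n} {m} f = trans (sum-splitAt n (f ∘ map₂ (remQuot m))) (+-congˡ (sum-remQuot n (f ∘ inj₂)))

  sum-∘vertexIndex : ∀ {n m} (f : Vertex n m → Carrier) (g : Vector Carrier (n ℕ.+ n ℕ.* m)) →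
                     sum (λ q → f (vertex {n} {m} q) * g q) ≈
                     sum (λ i → f (inj₁ i) * g (vertexIndex {n} {m} (inj₁ i))) +
                     sum (λ i → sum (λ a → f (inj₂ (i , a)) * g (vertexIndex (inj₂ (i , a)))))
  sum-∘vertexIndex {n} {m} f g = trans
    (sum-cong-≋ λ q → *-congˡ {f (vertex {n} {m} q)} (reflexive (≡.cong g (≡.sym (vertexIndex-vertex {n} {m} q)))))
    (sum-vertex (λ p → f p * g (vertexIndex p)))

  -- Lower bound: independence of the selected columns of the corona.

  module _ {n} {A : Matrix n} {G : Graph n} (graph : HasGraph A G) where
    open Graph G

    adjacent⇒≉0 : ∀ {i j} → Adj i j → ¬ (A i j ≈ 0#)
    adjacent⇒≉0 {i} {j} adj = Equivalence.to (graph i j (λ { ≡.refl → irrefl adj })) adj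

    nonadjacent⇒≈0 : ∀ {i j} → i ≢ j → ¬ Adj i j → A i j ≈ 0#
    nonadjacent⇒≈0 {i} {j} i≢j ¬adj = decidable-stable (A i j ≈? 0#) (¬adj ∘ Equivalence.from (graph i j i≢j))

  module _ {n m g h} {G : Graph n} {H : Graph m}
           {B : Matrix (n ℕ.+ n ℕ.* m)} (psd : IsPositiveSemidefinite B) (graph : HasGraph B (G ∘ᶜ H))
           {v : Fin g → Fin n} (v-OS : IsOSVertexSet G v)
           {u : Fin h → Fin m} (u-OS : IsOSVertexSet H u)
           (a : Vector Carrier (n ℕ.* h ℕ.+ g)) (rel : ∀ i → sum (λ e → a e * B i (select {n} u v e)) ≈ 0#)
           where
    private
      module G = Graph G
      module H = Graph H

      Selected : Set
      Selected = Fin n × Fin h ⊎ Fin g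

      entry : Vertex n m → Vertex n m → Carrier
      entry p q = B (vertexIndex p) (vertexIndex q)

      coefficient : Selected → Carrier
      coefficient x = a (selectedIndex x)

      coronaAdjacent⇒≉0 : ∀ p q → CoronaAdj G H p q → ¬ (entry p q ≈ 0#)
      coronaAdjacent⇒≉0 p q adj = adjacent⇒≉0 {G = G ∘ᶜ H} graph
        (≡.subst₂ (CoronaAdj G H) (≡.sym (vertex-vertexIndex p)) (≡.sym (vertex-vertexIndex q)) adj)

      coronaNonadjacent⇒≈0 : ∀ p q → p ≢ q → ¬ CoronaAdj G H p q → entry p q ≈ 0#
      coronaNonadjacent⇒≈0 p q p≢q ¬adj = nonadjacent⇒≈0 {G = G ∘ᶜ H} graph
        (λ eq → p≢q (≡.trans (≡.sym (vertex-vertexIndex p)) (≡.trans (≡.cong vertex eq) (vertex-vertexIndex q))))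
        (¬adj ∘ ≡.subst₂ (CoronaAdj G H) (vertex-vertexIndex p) (vertex-vertexIndex q))

      -- Restates `separatedCoefficient` with columns named by elements of the two OS-vertex sets
      -- instead of positions in one list.
      separated : {C : Selected → Set} → (∀ x → Dec (C x)) →
                  (∀ x y → C x → ¬ C y → entry (selectVertex u v x) (selectVertex u v y) ≈ 0# ⊎ coefficient y ≈ 0#) →
                  ∀ k w → C k → CoronaAdj G H w (selectVertex u v k) →
                  (∀ x → C x → x ≢ k → entry w (selectVertex u v x) ≈ 0#) →
                  coefficient k ≈ 0#
      separated {C} C? cut k w Ck adj w⊥ = separatedCoefficient psd (select u v) a rel
        (C? ∘ selected)
        (λ {e} {e′} Ce ¬Ce′ → map₂ (trans (reflexive (≡.cong a (≡.sym (selectedIndex-selected {n} {h} {g} e′)))))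
                                   (cut (selected e) (selected e′) Ce ¬Ce′))
        (vertexIndex w)
        (≡.subst C (≡.sym (selected-selectedIndex k)) Ck)
        (coronaAdjacent⇒≉0 w _ (≡.subst (CoronaAdj G H w ∘ selectVertex u v) (≡.sym (selected-selectedIndex k)) adj))
        (λ {e} Ce e≢k → inj₁ (w⊥ (selected e) Ce λ eq →
          e≢k (≡.trans (≡.sym (selectedIndex-selected {n} {h} {g} e)) (≡.cong selectedIndex eq))))

      -- C consists of the component of v k in G together with the copies
      -- of H attached to it. Membership in the component is not decided
      -- here; it may be assumed decidable since the conclusion is ¬¬-stable.
      baseStep : ∀ k → (∀ {l} → k Fin.< l → coefficient (inj₂ l) ≈ 0#) → coefficient (inj₂ k) ≈ 0#
      baseStep k later = decidable-stable (coefficient (inj₂ k) ≈? 0#) λ c≉0 →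
        ¬¬-decidable (InComponent G v k) λ comp? → c≉0 (separated (C? comp?) cut (inj₂ k) (inj₁ w) ε (G.symm vk~w) w⊥)
        where
        w = proj₁ (proj₂ v-OS k)
        w≢ = proj₁ (proj₂ (proj₂ v-OS k))
        vk~w = proj₁ (proj₂ (proj₂ (proj₂ v-OS k)))
        w≁ = proj₂ (proj₂ (proj₂ (proj₂ v-OS k)))
        C : Selected → Set
        C (inj₁ (i , _)) = ∃[ l ] InComponent G v k l × v l ≡ i
        C (inj₂ l)       = InComponent G v k l
        C? : (∀ l → Dec (InComponent G v k l)) → ∀ x → Dec (C x)
        C? comp? (inj₁ (i , _)) = Fin.any? (λ l → comp? l ×-dec v l Fin.≟ i)
        C? comp? (inj₂ l)       = comp? l
        cut : ∀ x y → C x → ¬ C y → entry (selectVertex u v x) (selectVertex u v y) ≈ 0# ⊎ coefficient y ≈ 0#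
        -- A copy belongs to `C` exactly when the vertex it hangs from is in the component, so among
        -- selected vertices only edges of `G` can leave `C`.
        cut (inj₁ (i , s)) (inj₁ (i′ , s′)) Cx ¬Cy = inj₁ (coronaNonadjacent⇒≈0 (inj₂ (i , u s)) (inj₂ (i′ , u s′))
          (λ eq → ¬Cy (moved (≡.cong proj₁ (Sum.inj₂-injective eq)))) (¬Cy ∘ moved ∘ proj₁))
          where
          moved : i ≡ i′ → C (inj₁ (i′ , s′))
          moved i≡i′ = ≡.subst (λ j → C (inj₁ (j , s′))) i≡i′ Cx
        cut (inj₁ (i , s)) (inj₂ l′) (l , Cl , ≡.refl) ¬Cl′ = inj₁ (coronaNonadjacent⇒≈0 (inj₂ (i , u s)) (inj₁ (v l′))
          (λ ()) (λ vl≡vl′ → ¬Cl′ (≡.subst (InComponent G v k) (proj₁ v-OS vl≡vl′) Cl)))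
        cut (inj₂ l) (inj₁ (i , s)) Cl ¬Cy = inj₁ (coronaNonadjacent⇒≈0 (inj₁ (v l)) (inj₂ (i , u s))
          (λ ()) (λ vl≡i → ¬Cy (l , Cl , vl≡i)))
        -- An edge of `G` that leaves the component reaches a later position, whose coefficient is 0
        -- by induction.
        cut (inj₂ l) (inj₂ l′) Cl ¬Cl′ with G.adj? (v l) (v l′)
        ... | yes adj = inj₂ (later (component-cut G v Cl ¬Cl′ adj))
        ... | no ¬adj = inj₁ (coronaNonadjacent⇒≈0 (inj₁ (v l)) (inj₁ (v l′))
          (λ eq → ¬Cl′ (≡.subst (InComponent G v k) (proj₁ v-OS (Sum.inj₁-injective eq)) Cl)) ¬adj)
        w⊥ : ∀ x → C x → x ≢ inj₂ k → entry (inj₁ w) (selectVertex u v x) ≈ 0#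
        -- `w` differs from every `v l` with `l` up to `k`, so no copy in `C` hangs from it.
        w⊥ (inj₁ (i , s)) (l , Cl , ≡.refl) _ = coronaNonadjacent⇒≈0 (inj₁ w) (inj₂ (i , u s)) (λ ()) (w≢ l (component-bounded G v Cl))
        w⊥ (inj₂ l) Cl l≢k = coronaNonadjacent⇒≈0 (inj₁ w) (inj₁ (v l))
          (w≢ l (component-bounded G v Cl) ∘ Sum.inj₁-injective) (w≁ l Cl (l≢k ∘ ≡.cong inj₂))

      -- Descending induction, as `baseStep` assumes the coefficients at later positions to vanish.
      base≈0 : ∀ k → coefficient (inj₂ k) ≈ 0#
      base≈0 = WellFounded.All.wfRec Fin.>-wellFounded _ (λ k → coefficient (inj₂ k) ≈ 0#) baseStep

      -- Here `C` is the component of `u s` inside the `i`th copy alone. Its vertices have only one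
      -- neighbour outside the copy, the vertex of `G` it hangs from; if that one is selected, its
      -- coefficient is 0 by `base≈0`. So the argument for `H` by itself goes through.
      copyStep : ∀ i s → (∀ {t} → s Fin.< t → coefficient (inj₁ (i , t)) ≈ 0#) → coefficient (inj₁ (i , s)) ≈ 0#
      copyStep i s later = decidable-stable (coefficient (inj₁ (i , s)) ≈? 0#) λ c≉0 →
        ¬¬-decidable (InComponent H u s) λ comp? →
          c≉0 (separated (C? comp?) cut (inj₁ (i , s)) (inj₂ (i , w)) (≡.refl , ε) (≡.refl , H.symm us~w) w⊥)
        where
        w = proj₁ (proj₂ u-OS s)
        w≢ = proj₁ (proj₂ (proj₂ u-OS s))
        us~w = proj₁ (proj₂ (proj₂ (proj₂ u-OS s)))
        w≁ = proj₂ (proj₂ (proj₂ (proj₂ u-OS s)))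
        C : Selected → Set
        C (inj₁ (j , t)) = i ≡ j × InComponent H u s t
        C (inj₂ _)       = ⊥
        C? : (∀ t → Dec (InComponent H u s t)) → ∀ x → Dec (C x)
        C? comp? (inj₁ (j , t)) = i Fin.≟ j ×-dec comp? t
        C? comp? (inj₂ _)       = no λ ()
        cut : ∀ x y → C x → ¬ C y → entry (selectVertex u v x) (selectVertex u v y) ≈ 0# ⊎ coefficient y ≈ 0#
        cut x (inj₂ l) _ _ = inj₂ (base≈0 l)
        cut (inj₁ (j , t)) (inj₁ (j′ , t′)) (≡.refl , Ct) ¬Cy with i Fin.≟ j′
        ... | no i≢j′ = inj₁ (coronaNonadjacent⇒≈0 (inj₂ (i , u t)) (inj₂ (j′ , u t′)) (i≢j′ ∘ ≡.cong proj₁ ∘ Sum.inj₂-injective) (i≢j′ ∘ proj₁))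
        ... | yes ≡.refl with H.adj? (u t) (u t′)
        ...   | yes adj = inj₂ (later (component-cut H u Ct (¬Cy ∘ (≡.refl ,_)) adj))
        ...   | no ¬adj = inj₁ (coronaNonadjacent⇒≈0 (inj₂ (i , u t)) (inj₂ (i , u t′))
          (λ eq → ¬Cy (≡.refl , ≡.subst (InComponent H u s) (proj₁ u-OS (≡.cong proj₂ (Sum.inj₂-injective eq))) Ct))
          (¬adj ∘ proj₂))
        w⊥ : ∀ x → C x → x ≢ inj₁ (i , s) → entry (inj₂ (i , w)) (selectVertex u v x) ≈ 0#
        w⊥ (inj₁ (j , t)) (≡.refl , Ct) t≢s = coronaNonadjacent⇒≈0 (inj₂ (i , w)) (inj₂ (i , u t))
          (w≢ t (component-bounded H u Ct) ∘ ≡.cong proj₂ ∘ Sum.inj₂-injective)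
          (w≁ t Ct (t≢s ∘ ≡.cong (λ t → inj₁ (i , t))) ∘ proj₂)

      copy≈0 : ∀ i s → coefficient (inj₁ (i , s)) ≈ 0#
      copy≈0 i = WellFounded.All.wfRec Fin.>-wellFounded _ (λ s → coefficient (inj₁ (i , s)) ≈ 0#) (copyStep i)

      coefficient≈0 : ∀ x → coefficient x ≈ 0#
      coefficient≈0 (inj₁ (i , s)) = copy≈0 i s
      coefficient≈0 (inj₂ k)       = base≈0 k

    corona-relation≈0 : ∀ e → a e ≈ 0#
    corona-relation≈0 e = trans (reflexive (≡.cong a (≡.sym (selectedIndex-selected {n} {h} {g} e)))) (coefficient≈0 (selected e))

  -- Upper bound: a positive semidefinite matrix for the corona.

  module _ {n m} {A : Matrix n} {B : Matrix m} (psdA : IsPositiveSemidefinite A) (psdB : IsPositiveSemidefinite B)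
           (y : Vector Carrier m) where
    private
      By : Vector Carrier m
      By = B *ᵥ y

      hermA = proj₁ psdA
      hermB = proj₁ psdB

      -- In block form this is (A ⊕ 0) + T* (I ⊗ B) T, where T sends x to the vectors zᵢ. In the
      -- block of `A` only the diagonal changes, so the graph of `A` survives.
      entry : Vertex n m → Vertex n m → Carrier
      entry (inj₁ i)       (inj₁ j)       = A i j + δ i j * ⟨ By , y ⟩
      entry (inj₁ i)       (inj₂ (j , b)) = δ i j * conj (By b)
      entry (inj₂ (i , a)) (inj₁ j)       = δ i j * By a
      entry (inj₂ (i , a)) (inj₂ (j , b)) = δ i j * B a b

    coronaMatrix : Matrix (n ℕ.+ n ℕ.* m)
    coronaMatrix p q = entry (vertex p) (vertex q)

    private
      conj-δ* : ∀ {k} (i j : Fin k) {x x′} → conj x ≈ x′ → δ i j * x′ ≈ conj (δ j i * x)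
      conj-δ* i j {x} {x′} x̄≈x′ = begin
        δ i j * x′            ≈⟨ *-cong (trans (δ-comm i j) (sym (conj-δ j i))) (sym x̄≈x′) ⟩
        conj (δ j i) * conj x ≈⟨ conj-* _ _ ⟨
        conj (δ j i * x)      ∎

      entry-hermitian : ∀ p q → entry p q ≈ conj (entry q p)
      entry-hermitian (inj₁ i)       (inj₁ j)       = trans
        (+-cong (hermA i j) (conj-δ* i j (trans (⟨⟩-conj By y) (⟨⟩-adjoint hermB y y)))) (sym (conj-+ _ _))
      entry-hermitian (inj₁ i)       (inj₂ (j , b)) = conj-δ* i j refl
      entry-hermitian (inj₂ (i , a)) (inj₁ j)       = conj-δ* i j (conj-involutive _)
      entry-hermitian (inj₂ (i , a)) (inj₂ (j , b)) = conj-δ* i j (sym (hermB a b))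

      module _ (x : Vector Carrier (n ℕ.+ n ℕ.* m)) where
        x₁ : Vector Carrier n
        x₁ i = x (vertexIndex {n} {m} (inj₁ i))

        x₂ : Fin n → Vector Carrier m
        x₂ i a = x (vertexIndex (inj₂ (i , a)))

        z : Fin n → Vector Carrier m
        z i b = x₁ i * y b + 1# * x₂ i b

        -- The product with `x`, indexed by vertices: `row (vertex p)` is entry `p` of
        -- `coronaMatrix *ᵥ x` by definition.
        row : Vertex n m → Carrier
        row p = sum λ q → entry p (vertex q) * x q

        sum-δ* : ∀ {k} (i : Fin k) (f g : Vector Carrier k) → sum (λ j → δ i j * f j * g j) ≈ f i * g i
        sum-δ* i f g = trans (sum-cong-≋ λ j → *-assoc (δ i j) (f j) (g j)) (sum-δ i (λ j → f j * g j))

        sum-sum-δ* : ∀ {k} (i : Fin n) (f : Vector Carrier k) (g : Fin n → Vector Carrier k) →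
                     sum (λ j → sum (λ b → δ i j * f b * g j b)) ≈ sum (λ b → f b * g i b)
        sum-sum-δ* i f g = begin
          sum (λ j → sum (λ b → δ i j * f b * g j b))
            ≈⟨ sum-cong-≋ (λ j → trans (sum-cong-≋ λ b → *-assoc (δ i j) (f b) (g j b)) (sym (*-distribˡ-sum (δ i j) (λ b → f b * g j b)))) ⟩
          sum (λ j → δ i j * sum (λ b → f b * g j b))
            ≈⟨ sum-δ i (λ j → sum (λ b → f b * g j b)) ⟩
          sum (λ b → f b * g i b) ∎

        row-copy : ∀ i a → row (inj₂ (i , a)) ≈ (B *ᵥ z i) a
        row-copy i a = begin
          row (inj₂ (i , a))
            ≈⟨ sum-∘vertexIndex (entry (inj₂ (i , a))) x ⟩
          sum (λ j → δ i j * By a * x₁ j) + sum (λ j → sum (λ b → δ i j * B a b * x₂ j b))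
            ≈⟨ +-cong (sum-δ* i (λ _ → By a) x₁) (sum-sum-δ* i (B a) x₂) ⟩
          By a * x₁ i + (B *ᵥ x₂ i) a
            ≈⟨ +-cong (*-comm _ _) (sym (*-identityˡ _)) ⟩
          x₁ i * By a + 1# * (B *ᵥ x₂ i) a
            ≈⟨ sum-linear (B a) y (x₂ i) (x₁ i) 1# ⟨
          (B *ᵥ z i) a ∎

        -- The diagonal correction and the entries towards the `i`th copy combine to `⟨ By , z i ⟩`.
        -- It is moved to the other side so that it visibly vanishes as soon as `B *ᵥ z i` does.
        row-base : ∀ i → row (inj₁ i) ≈ (A *ᵥ x₁) i + ⟨ y , B *ᵥ z i ⟩
        row-base i = begin
          row (inj₁ i)
            ≈⟨ sum-∘vertexIndex (entry (inj₁ i)) x ⟩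
          sum (λ j → (A i j + δ i j * ⟨ By , y ⟩) * x₁ j) + sum (λ j → sum (λ b → δ i j * conj (By b) * x₂ j b))
            ≈⟨ +-cong (trans (sum-cong-≋ λ j → distribʳ (x₁ j) (A i j) (δ i j * ⟨ By , y ⟩))
                             (∑-distrib-+ (λ j → A i j * x₁ j) (λ j → δ i j * ⟨ By , y ⟩ * x₁ j)))
                      (sum-sum-δ* i (conj ∘ By) x₂) ⟩
          (A *ᵥ x₁) i + sum (λ j → δ i j * ⟨ By , y ⟩ * x₁ j) + ⟨ By , x₂ i ⟩
            ≈⟨ trans (+-assoc _ _ _) (+-congˡ (+-cong (trans (sum-δ* i (λ _ → ⟨ By , y ⟩) x₁) (*-comm _ _)) (sym (*-identityˡ _)))) ⟩
          (A *ᵥ x₁) i + (x₁ i * ⟨ By , y ⟩ + 1# * ⟨ By , x₂ i ⟩)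
            ≈⟨ +-congˡ (⟨⟩-linearʳ By y (x₂ i) (x₁ i) 1#) ⟨
          (A *ᵥ x₁) i + ⟨ By , z i ⟩
            ≈⟨ +-congˡ (⟨⟩-adjoint hermB y (z i)) ⟨
          (A *ᵥ x₁) i + ⟨ y , B *ᵥ z i ⟩ ∎

        -- After `row-base` and `row-copy`, everything except the form of `A` is paired with
        -- `B *ᵥ z i`; the left factors `y`, weighted by `x₁ i`, and `x₂ i` add up to `z i`.
        form : ⟨ x , coronaMatrix *ᵥ x ⟩ ≈ ⟨ x₁ , A *ᵥ x₁ ⟩ + sum (λ i → ⟨ z i , B *ᵥ z i ⟩)
        form = begin
          ⟨ x , coronaMatrix *ᵥ x ⟩
            ≈⟨ sum-cong-≋ (λ q → *-comm (conj (x q)) (row (vertex q))) ⟩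
          sum (λ q → row (vertex {n} {m} q) * conj (x q))
            ≈⟨ sum-∘vertexIndex row (conj ∘ x) ⟩
          sum (λ i → row (inj₁ i) * conj (x₁ i)) + sum (λ i → sum (λ a → row (inj₂ (i , a)) * conj (x₂ i a)))
            ≈⟨ +-cong (sum-cong-≋ λ i → trans (*-comm _ _) (trans (*-congˡ (row-base i)) (distribˡ (conj (x₁ i)) ((A *ᵥ x₁) i) ⟨ y , B *ᵥ z i ⟩)))
                      (sum-cong-≋ λ i → sum-cong-≋ λ a → trans (*-comm _ _) (*-congˡ (row-copy i a))) ⟩
          sum (λ i → conj (x₁ i) * (A *ᵥ x₁) i + conj (x₁ i) * ⟨ y , B *ᵥ z i ⟩) + sum (λ i → ⟨ x₂ i , B *ᵥ z i ⟩)
            ≈⟨ +-congʳ (∑-distrib-+ (λ i → conj (x₁ i) * (A *ᵥ x₁) i) (λ i → conj (x₁ i) * ⟨ y , B *ᵥ z i ⟩)) ⟩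
          ⟨ x₁ , A *ᵥ x₁ ⟩ + sum (λ i → conj (x₁ i) * ⟨ y , B *ᵥ z i ⟩) + sum (λ i → ⟨ x₂ i , B *ᵥ z i ⟩)
            ≈⟨ trans (+-assoc _ _ _) (+-congˡ (sym (∑-distrib-+ (λ i → conj (x₁ i) * ⟨ y , B *ᵥ z i ⟩) (λ i → ⟨ x₂ i , B *ᵥ z i ⟩)))) ⟩
          ⟨ x₁ , A *ᵥ x₁ ⟩ + sum (λ i → conj (x₁ i) * ⟨ y , B *ᵥ z i ⟩ + ⟨ x₂ i , B *ᵥ z i ⟩)
            ≈⟨ +-congˡ (sum-cong-≋ λ i → trans (⟨⟩-linearˡ y (x₂ i) (B *ᵥ z i) (x₁ i) 1#)
                                                (+-congˡ (trans (*-congʳ conj-1) (*-identityˡ _)))) ⟨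
          ⟨ x₁ , A *ᵥ x₁ ⟩ + sum (λ i → ⟨ z i , B *ᵥ z i ⟩) ∎

    coronaMatrix-psd : IsPositiveSemidefinite coronaMatrix
    coronaMatrix-psd = (λ p q → entry-hermitian (vertex p) (vertex q)) , λ x →
      nonNegative-resp-≈ (trans (sym (form x)) (sym (quadraticForm coronaMatrix x)))
        (nonNegative-+ (psd-nonNegative psdA (x₁ x)) (nonNegative-sum λ i → psd-nonNegative psdB (z x i)))

    -- The selected rows in the copies give `B *ᵥ z i` equal to 0 through `detB`. The rows of `G`
    -- then reduce to those of `A *ᵥ x₁`, and `detA` finishes.
    coronaMatrix-determining : ∀ {g h} {σ : Fin g → Fin n} {τ : Fin h → Fin m} → IsDetermining A σ → IsDetermining B τ →
                               IsDetermining coronaMatrix (select {n} τ σ)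
    coronaMatrix-determining {g} {h} {σ} {τ} detA detB x Mx≈0 = row≈0 ∘ vertex
      where
      selectedRow≈0 : ∀ s → row x (selectVertex τ σ s) ≈ 0#
      selectedRow≈0 s = trans (reflexive (≡.cong (row x) (≡.sym (≡.trans
        (vertex-vertexIndex (selectVertex τ σ (selected (selectedIndex s))))
        (≡.cong (selectVertex τ σ) (selected-selectedIndex s)))))) (Mx≈0 (selectedIndex s))
      Bz≈0 : ∀ i a → (B *ᵥ z x i) a ≈ 0#
      Bz≈0 i = detB (z x i) λ e → trans (sym (row-copy x i (τ e))) (selectedRow≈0 (inj₁ (i , e)))
      row₁≈Ax₁ : ∀ i → row x (inj₁ i) ≈ (A *ᵥ x₁ x) i
      row₁≈Ax₁ i = trans (row-base x i) (trans (+-congˡ (⟨⟩-zeroʳ y (Bz≈0 i))) (+-identityʳ _))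
      row≈0 : ∀ p → row x p ≈ 0#
      row≈0 (inj₁ i)       = trans (row₁≈Ax₁ i) (detA (x₁ x) (λ e → trans (sym (row₁≈Ax₁ (σ e))) (selectedRow≈0 (inj₂ e))) i)
      row≈0 (inj₂ (i , a)) = trans (row-copy x i a) (Bz≈0 i a)

    module _ {G : Graph n} {H : Graph m} (graphA : HasGraph A G) (graphB : HasGraph B H) (By≉0 : ∀ a → ¬ (By a ≈ 0#)) where
      private
        δ*-≉0 : ∀ {i j : Fin n} {x} → ¬ (x ≈ 0#) → i ≡ j → ¬ (δ i j * x ≈ 0#)
        δ*-≉0 {i} x≉0 ≡.refl = λ δx≈0 → x≉0 (trans (sym (trans (*-congʳ (δ-refl i)) (*-identityˡ _))) δx≈0)

        δ*-≉0⇒≡ : ∀ {i j : Fin n} {x} → ¬ (δ i j * x ≈ 0#) → i ≡ j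
        δ*-≉0⇒≡ {i} {j} δx≉0 = decidable-stable (i Fin.≟ j) λ i≢j → δx≉0 (trans (*-congʳ (δ-≢ i≢j)) (zeroˡ _))

        entry-graph : ∀ p q → p ≢ q → CoronaAdj G H p q ⇔ (¬ (entry p q ≈ 0#))
        entry-graph (inj₁ i) (inj₁ j) p≢q = mk⇔
          (λ adj e → Equivalence.to (graphA i j i≢j) adj (trans (sym offDiagonal) e))
          (λ e≉0 → Equivalence.from (graphA i j i≢j) (e≉0 ∘ trans offDiagonal))
          where
          i≢j : i ≢ j
          i≢j = p≢q ∘ ≡.cong inj₁
          offDiagonal : entry (inj₁ i) (inj₁ j) ≈ A i j
          offDiagonal = trans (+-congˡ (trans (*-congʳ (δ-≢ i≢j)) (zeroˡ _))) (+-identityʳ _)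
        -- `By≉0` supplies every edge between a vertex and its own copy, and `δ` excludes all
        -- others.
        entry-graph (inj₁ i) (inj₂ (j , b)) _ = mk⇔ (δ*-≉0 (By≉0 b ∘ conj≈0⇒≈0)) δ*-≉0⇒≡
        entry-graph (inj₂ (i , a)) (inj₁ j) _ = mk⇔ (δ*-≉0 (By≉0 a)) δ*-≉0⇒≡
        entry-graph (inj₂ (i , a)) (inj₂ (j , b)) p≢q = mk⇔
          (λ { (≡.refl , adj) → δ*-≉0 {i} (adjacent⇒≉0 {G = H} graphB adj) ≡.refl })
          (λ e≉0 → δ*-≉0⇒≡ e≉0 , Equivalence.from (graphB a b (λ a≡b → p≢q (≡.cong₂ (λ i a → inj₂ (i , a)) (δ*-≉0⇒≡ e≉0) a≡b)))
                                    (λ B≈0 → e≉0 (trans (*-congˡ B≈0) (zeroʳ _))))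

      coronaMatrix-graph : HasGraph coronaMatrix (G ∘ᶜ H)
      coronaMatrix-graph p q p≢q = entry-graph (vertex p) (vertex q)
        (λ eq → p≢q (≡.trans (≡.sym (vertexIndex-vertex {n} {m} p)) (≡.trans (≡.cong vertexIndex eq) (vertexIndex-vertex {n} {m} q))))

  -- The minimum rank of the corona over one kind of scalars.

  -- The independent columns serve twice: for `M` they show that the bound from `detM` is attained,
  -- and for an arbitrary competitor `C` they bound its rank from below.
  corona-minimumPSDRank :
    ∀ {n m g h} {G : Graph n} {H : Graph m} → (∀ a → ∃ (Graph.Adj H a)) →
    IsMinimumPSDRank G g → Σ (Fin g → Fin n) (IsOSVertexSet G) →
    IsMinimumPSDRank H h → Σ (Fin h → Fin m) (IsOSVertexSet H) →
    IsMinimumPSDRank (G ∘ᶜ H) (n ℕ.* h ℕ.+ g)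
  corona-minimumPSDRank {n} {m} {g} {h} {G} {H} neighbour
    ((A , psdA , graphA , rankA) , _) (v , v-OS) ((B , psdB , graphB , rankB) , _) (u , u-OS) =
    (M , psdM , graphM , (select {n} u v , independent psdM graphM) , λ k (τ , τ-independent) → determining⇒rank≤ detM τ τ-independent) ,
    λ r (C , psdC , graphC , _ , maximal) → maximal _ (select {n} u v , independent psdC graphC)
    where
    independent : ∀ {C : Matrix (n ℕ.+ n ℕ.* m)} → IsPositiveSemidefinite C → HasGraph C (G ∘ᶜ H) →
                  LinearlyIndependent (λ e i → C i (select {n} u v e))
    independent psd graph = corona-relation≈0 {G = G} {H} psd graph v-OS u-OS
    -- A neighbour of `a` yields the nonzero entry in row `a` of `B` that a generic vector requires.
    generic = genericVector B λ a → let b , adj = neighbour a in b , adjacent⇒≉0 {G = H} graphB adj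
    y = proj₁ generic
    M = coronaMatrix psdA psdB y
    psdM = coronaMatrix-psd psdA psdB y
    graphM = coronaMatrix-graph psdA psdB y {G} {H} graphA graphB (proj₂ generic)
    detM = coronaMatrix-determining psdA psdB y
      (proj₂ (hermitian-rank⇒determining (proj₁ psdA) rankA)) (proj₂ (hermitian-rank⇒determining (proj₁ psdB) rankB))

-- The real and the complex numbers as involutive fields.

module _ {ℓ} (ℛ : Reals ℓ) where
  open Reals ℛ
  open IsDecTotalOrder isDecTotalOrder using (_≟_; antisym; total; ≤-respʳ-≈; ≤-respˡ-≈; ≤-resp-≈) renaming (trans to ≤-trans)
  open Algebra.Properties.Ring ring using (-‿distribˡ-*; -‿distribʳ-*; -1*x≈-x)
  open Algebra.Properties.AbelianGroup +-abelianGroup using () renaming (⁻¹-∙-comm to -‿+-comm)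
  open Algebra.Properties.Group +-group using (⁻¹-involutive; ε⁻¹≈ε)
  open Algebra.Solver.Ring.NaturalCoefficients.Default commutativeSemiring using (solve; _:=_; _:+_; _:*_)
  open Relation.Binary.Reasoning.Setoid setoid

  private
    x≤0⇒0≤-x : ∀ {x} → x ≤ 0# → 0# ≤ - x
    x≤0⇒0≤-x {x} x≤0 = ≤-respʳ-≈ (+-identityʳ _) (≤-respˡ-≈ (-‿inverseˡ x) (+-monoʳ-≤ (- x) x≤0))

    0≤-x⇒x≤0 : ∀ {x} → 0# ≤ - x → x ≤ 0#
    0≤-x⇒x≤0 {x} 0≤-x = ≤-respʳ-≈ (-‿inverseʳ x) (≤-respˡ-≈ (+-identityʳ x) (+-monoʳ-≤ x 0≤-x))

    0≤x+y : ∀ {x y} → 0# ≤ x → 0# ≤ y → 0# ≤ x + y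
    0≤x+y {x} 0≤x 0≤y = ≤-trans 0≤x (≤-respˡ-≈ (+-identityʳ x) (+-monoʳ-≤ x 0≤y))

    -x*-y≈x*y : ∀ x y → - x * - y ≈ x * y
    -x*-y≈x*y x y = begin
      - x * - y      ≈⟨ -‿distribˡ-* x (- y) ⟨
      - (x * - y)    ≈⟨ -‿cong (-‿distribʳ-* x y) ⟨
      - - (x * y)    ≈⟨ ⁻¹-involutive _ ⟩
      x * y          ∎

    0≤x*x : ∀ x → 0# ≤ x * x
    0≤x*x x with total 0# x
    ... | inj₁ 0≤x = *-nonNegative 0≤x 0≤x
    ... | inj₂ x≤0 = ≤-respʳ-≈ (-x*-y≈x*y x x) (*-nonNegative (x≤0⇒0≤-x x≤0) (x≤0⇒0≤-x x≤0))

  real-isInvolutiveField : IsInvolutiveField (realScalars ℛ)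
  real-isInvolutiveField = record
    { isCommutativeRing       = isCommutativeRing
    ; _≈?_                    = _≟_
    ; 1≉0                     = 1≉0
    ; inverse                 = inverse
    ; conj-isRingHomomorphism = Algebra.Morphism.Construct.Identity.isRingHomomorphism rawRing refl
    ; conj-involutive         = λ _ → refl
    ; nonNegative-resp-≈      = ≤-respʳ-≈
    ; nonNegative-+           = 0≤x+y
    ; nonNegative-*           = *-nonNegative
    ; nonNegative-norm        = 0≤x*x
    ; nonNegative⇒conj≈       = λ _ → refl
    ; nonNegative-antisym     = λ 0≤x 0≤-x → antisym (0≤-x⇒x≤0 0≤-x) 0≤x
    }

  private
    open module ℂ = Scalars (complexScalars ℛ) using () renaming (Carrier to ℂ; _≈_ to _≈ᶜ_; _*_ to _*ᶜ_)

    x-y≈x+-1*y : ∀ x y → x - y ≈ x + - 1# * y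
    x-y≈x+-1*y x y = +-congˡ (sym (-1*x≈-x y))

    x-y*-z≈x+y*z : ∀ x y z → x - y * - z ≈ x + y * z
    x-y*-z≈x+y*z x y z = +-congˡ (trans (-‿cong (sym (-‿distribʳ-* y z))) (⁻¹-involutive _))

    *ᶜ-cong : ∀ {z z′ w w′} → z ≈ᶜ z′ → w ≈ᶜ w′ → z *ᶜ w ≈ᶜ z′ *ᶜ w′
    *ᶜ-cong (a≈ , b≈) (c≈ , d≈) =
      +-cong (*-cong a≈ c≈) (-‿cong (*-cong b≈ d≈)) , +-cong (*-cong a≈ d≈) (*-cong b≈ c≈)

    *ᶜ-comm : ∀ z w → z *ᶜ w ≈ᶜ w *ᶜ z
    *ᶜ-comm (a , b) (c , d) =
      +-cong (*-comm a c) (-‿cong (*-comm b d)) , trans (+-comm _ _) (+-cong (*-comm b c) (*-comm a d))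

    -- Once the subtractions are written as multiplications by the
    -- constant − 1, this is an identity of semirings.
    *ᶜ-assoc : ∀ z w v → (z *ᶜ w) *ᶜ v ≈ᶜ z *ᶜ (w *ᶜ v)
    *ᶜ-assoc (a , b) (c , d) (e , f) =
      (begin
        (a * c - b * d) * e - (a * d + b * c) * f
          ≈⟨ trans (x-y≈x+-1*y _ _) (+-congʳ (*-congʳ (x-y≈x+-1*y _ _))) ⟩
        (a * c + - 1# * (b * d)) * e + - 1# * ((a * d + b * c) * f)
          ≈⟨ solve 7 (λ a b c d e f i → (a :* c :+ i :* (b :* d)) :* e :+ i :* ((a :* d :+ b :* c) :* f)
               := a :* (c :* e :+ i :* (d :* f)) :+ i :* (b :* (c :* f :+ d :* e))) refl a b c d e f (- 1#) ⟩
        a * (c * e + - 1# * (d * f)) + - 1# * (b * (c * f + d * e))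
          ≈⟨ trans (x-y≈x+-1*y _ _) (+-congʳ (*-congˡ (x-y≈x+-1*y _ _))) ⟨
        a * (c * e - d * f) - b * (c * f + d * e) ∎) ,
      (begin
        (a * c - b * d) * f + (a * d + b * c) * e
          ≈⟨ +-congʳ (*-congʳ (x-y≈x+-1*y _ _)) ⟩
        (a * c + - 1# * (b * d)) * f + (a * d + b * c) * e
          ≈⟨ solve 7 (λ a b c d e f i → (a :* c :+ i :* (b :* d)) :* f :+ (a :* d :+ b :* c) :* e
               := a :* (c :* f :+ d :* e) :+ b :* (c :* e :+ i :* (d :* f))) refl a b c d e f (- 1#) ⟩
        a * (c * f + d * e) + b * (c * e + - 1# * (d * f))
          ≈⟨ +-congˡ (*-congˡ (x-y≈x+-1*y _ _)) ⟨
        a * (c * f + d * e) + b * (c * e - d * f) ∎)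

    *ᶜ-distribˡ : ∀ z w v → z *ᶜ (w ℂ.+ v) ≈ᶜ (z *ᶜ w) ℂ.+ (z *ᶜ v)
    *ᶜ-distribˡ (a , b) (c , d) (e , f) =
      (begin
        a * (c + e) - b * (d + f)
          ≈⟨ x-y≈x+-1*y _ _ ⟩
        a * (c + e) + - 1# * (b * (d + f))
          ≈⟨ solve 7 (λ a b c d e f i → a :* (c :+ e) :+ i :* (b :* (d :+ f))
               := (a :* c :+ i :* (b :* d)) :+ (a :* e :+ i :* (b :* f))) refl a b c d e f (- 1#) ⟩
        (a * c + - 1# * (b * d)) + (a * e + - 1# * (b * f))
          ≈⟨ +-cong (x-y≈x+-1*y _ _) (x-y≈x+-1*y _ _) ⟨
        (a * c - b * d) + (a * e - b * f) ∎) ,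
      solve 6 (λ a b c d e f → a :* (d :+ f) :+ b :* (c :+ e)
        := (a :* d :+ b :* c) :+ (a :* f :+ b :* e)) refl a b c d e f

    *ᶜ-identityˡ : ∀ z → ℂ.1# *ᶜ z ≈ᶜ z
    *ᶜ-identityˡ (a , b) =
      trans (+-cong (*-identityˡ a) (trans (-‿cong (zeroˡ b)) ε⁻¹≈ε)) (+-identityʳ a) ,
      trans (+-cong (*-identityˡ b) (zeroˡ a)) (+-identityʳ b)

    complex-isCommutativeRing : IsCommutativeRing _≈ᶜ_ ℂ._+_ _*ᶜ_ ℂ.-_ ℂ.0# ℂ.1#
    complex-isCommutativeRing = record
      { isRing = record
        { +-isAbelianGroup = AbelianGroup.isAbelianGroup (DirectProduct.abelianGroup +-abelianGroup +-abelianGroup)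
        ; *-cong           = *ᶜ-cong
        ; *-assoc          = *ᶜ-assoc
        ; *-identity       = comm∧idˡ⇒id *ᶜ-comm *ᶜ-identityˡ
        ; distrib          = comm∧distrˡ⇒distr (λ (a≈ , b≈) (c≈ , d≈) → +-cong a≈ c≈ , +-cong b≈ d≈) *ᶜ-comm *ᶜ-distribˡ
        }
      ; *-comm = *ᶜ-comm
      }
      where
      open Algebra.Consequences.Setoid (×-setoid setoid setoid)

    complex-conj-isRingHomomorphism : IsRingHomomorphism ℂ.rawRing ℂ.rawRing ℂ.conj
    complex-conj-isRingHomomorphism = record
      { isSemiringHomomorphism = record
        { isNearSemiringHomomorphism = record
          { +-isMonoidHomomorphism = record
            { isMagmaHomomorphism = record
              { isRelHomomorphism = record { cong = λ (a≈ , b≈) → a≈ , -‿cong b≈ }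
              ; homo              = λ (a , b) (c , d) → refl , sym (-‿+-comm b d)
              }
            ; ε-homo = refl , ε⁻¹≈ε
            }
          ; *-homo = λ (a , b) (c , d) →
              +-congˡ (-‿cong (sym (-x*-y≈x*y b d))) ,
              trans (sym (-‿+-comm (a * d) (b * c))) (+-cong (-‿distribʳ-* a d) (-‿distribˡ-* b c))
          }
        ; 1#-homo = refl , ε⁻¹≈ε
        }
      ; -‿homo = λ _ → refl , refl
      }

    -- The conjugate divided by the squared modulus, which is nonzero because a sum of two squares
    -- vanishes only if both terms do.
    complex-inverse : ∀ z → ¬ (z ≈ᶜ ℂ.0#) → ∃[ w ] z *ᶜ w ≈ᶜ ℂ.1#
    complex-inverse (a , b) z≉0 =
      let w , Nw≈1 = inverse (a * a + b * b) N≉0 in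
      (a * w , - (b * w)) ,
      (begin
        a * (a * w) - b * - (b * w)
          ≈⟨ x-y*-z≈x+y*z _ _ _ ⟩
        a * (a * w) + b * (b * w)
          ≈⟨ solve 3 (λ a b w → a :* (a :* w) :+ b :* (b :* w) := (a :* a :+ b :* b) :* w) refl a b w ⟩
        (a * a + b * b) * w
          ≈⟨ Nw≈1 ⟩
        1# ∎) ,
      (begin
        a * - (b * w) + b * (a * w)
          ≈⟨ +-cong (sym (-‿distribʳ-* a (b * w))) (solve 3 (λ a b w → b :* (a :* w) := a :* (b :* w)) refl a b w) ⟩
        - (a * (b * w)) + a * (b * w)
          ≈⟨ -‿inverseˡ _ ⟩
        0# ∎)
      where
      -- ℝ is already known to be an involutive field, so the general lemmas apply to the real
      -- numbers `a` and `b`.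
      open LinearAlgebra (realScalars ℛ) real-isInvolutiveField using (x+y≈0⇒x≈0; x*x≈0⇒x≈0)
      N≉0 : ¬ (a * a + b * b ≈ 0#)
      N≉0 N≈0 = z≉0
        ( x*x≈0⇒x≈0 (x+y≈0⇒x≈0 (0≤x*x a) (0≤x*x b) N≈0)
        , x*x≈0⇒x≈0 (x+y≈0⇒x≈0 (0≤x*x b) (0≤x*x a) (trans (+-comm _ _) N≈0)) )

  complex-isInvolutiveField : IsInvolutiveField (complexScalars ℛ)
  complex-isInvolutiveField = record
    { isCommutativeRing       = complex-isCommutativeRing
    ; _≈?_                    = λ (a , b) (c , d) → a ≟ c ×-dec b ≟ d
    ; 1≉0                     = 1≉0 ∘ proj₁
    ; inverse                 = complex-inverse
    ; conj-isRingHomomorphism = complex-conj-isRingHomomorphism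
    ; conj-involutive         = λ (a , b) → refl , ⁻¹-involutive b
    ; nonNegative-resp-≈      = λ (a≈ , b≈) (b≈0 , 0≤a) → trans (sym b≈) b≈0 , ≤-respʳ-≈ a≈ 0≤a
    ; nonNegative-+           = λ (b≈0 , 0≤a) (d≈0 , 0≤c) → trans (+-cong b≈0 d≈0) (+-identityʳ 0#) , 0≤x+y 0≤a 0≤c
    ; nonNegative-*           = λ {(a , b)} {(c , d)} (b≈0 , 0≤a) (d≈0 , 0≤c) →
        trans (+-cong (trans (*-congˡ d≈0) (zeroʳ a)) (trans (*-congʳ b≈0) (zeroˡ c))) (+-identityʳ 0#) ,
        ≤-respʳ-≈ (sym (trans (+-congˡ (trans (-‿cong (trans (*-congʳ b≈0) (zeroˡ d))) ε⁻¹≈ε)) (+-identityʳ _)))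
          (*-nonNegative 0≤a 0≤c)
    ; nonNegative-norm        = λ (a , b) →
        trans (+-cong (*-comm a b) (sym (-‿distribˡ-* b a))) (-‿inverseʳ _) ,
        ≤-respʳ-≈ (sym (trans (+-congˡ (-‿cong (*-comm (- b) b))) (x-y*-z≈x+y*z _ _ _)))
          (0≤x+y (0≤x*x a) (0≤x*x b))
    ; nonNegative⇒conj≈       = λ (b≈0 , _) → refl , trans (-‿cong b≈0) (trans ε⁻¹≈ε (sym b≈0))
    ; nonNegative-antisym     = λ (b≈0 , 0≤a) (_ , 0≤-a) → antisym (0≤-x⇒x≤0 0≤-a) 0≤a , b≈0
    }

-- The theorem for connected graphs.

-- A path from `a` to another vertex has a first edge; with at least two vertices, `punchIn a zero`
-- is such a vertex.
connected⇒∃adj : ∀ {m} (H : Graph m) → 2 ℕ.≤ m → Connected H → ∀ a → ∃ (Graph.Adj H a)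
connected⇒∃adj H (ℕ.s≤s (ℕ.s≤s _)) conn a = firstEdge (conn a (punchIn a zero)) (Fin.punchInᵢ≢i a zero ∘ ≡.sym)
  where
  firstEdge : ∀ {b c} → Star (Graph.Adj H) b c → b ≢ c → ∃ (Graph.Adj H b)
  firstEdge ε           b≢b = contradiction ≡.refl b≢b
  firstEdge (adj ◅ _) _   = _ , adj

open import Data.Nat.Base using (_+_; _*_; _≤_)

theorem3p12 : ∀ {ℓ} (ℛ : Reals ℓ) (n m : ℕ) (G : Graph n) (H : Graph m) (g h : ℕ) →
  2 ≤ n → Connected G → IsMr₊ ℛ G g → IsOSNumber G g →
  2 ≤ m → Connected H → IsMr₊ ℛ H h → IsOSNumber H h →
  IsMr₊ ℛ (G ∘ᶜ H) (n * h + g)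
theorem3p12 ℛ n m G H g h _ _ (realG , complexG) (osG , _) 2≤m connH (realH , complexH) (osH , _) =
  LinearAlgebra.corona-minimumPSDRank _ (real-isInvolutiveField ℛ) {G = G} {H} neighbour realG osG realH osH ,
  LinearAlgebra.corona-minimumPSDRank _ (complex-isInvolutiveField ℛ) {G = G} {H} neighbour complexG osG complexH osH
  where neighbour = connected⇒∃adj H 2≤m connH
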